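{- For every sufficiently large integer $n$ with $n \equiv 0 \pmod 3$, there exists an order-$n$ Latin square with at most \[ \left(\frac{n}{e^{2.117}}\right)^n \] transversals.
   Context: An order-$n$ Latin square is an $n\times n$ array filled with $n$ symbols such that each row and each column contains each symbol exactly once. A transversal of an order-$n$ Latin square is a collection of $n$ cells, no two of which share a row, a column, or a symbol. -}

module Defs where

open import Data.Nat using (ℕ; zero; suc; _*_; _^_; NonZero; _!)
open import Data.Nat.Properties using (m*n≢0; _!≢0)
open import Data.Fin using (Fin)
open import Data.Product using (∃!)
open import Relation.Binary.PropositionalEquality using (_≡_)
open import Function.Definitions using (Injective)
import Data.Integer as ℤ
open import Data.Rational using (ℚ; _/_; 0ℚ; _≤_)
  renaming (_*_ to _*ℚ_; _+_ to _+ℚ_)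

record LatinSquare (n : ℕ) : Set where
  field
    cell      : Fin n → Fin n → Fin n
    rowLatin  : ∀ (r s : Fin n) → ∃! _≡_ (λ c → cell r c ≡ s)
    colLatin  : ∀ (c s : Fin n) → ∃! _≡_ (λ r → cell r c ≡ s)

-- A transversal: a set of n cells, no two sharing a row, column or symbol.
-- Since the n cells lie in distinct rows, there is exactly one cell in each
-- row, so the set is {(r , col r) | r : Fin n} for a unique function col;
-- distinct columns = col injective; distinct symbols = r ↦ cell r (col r)
-- injective.
record Transversal {n : ℕ} (L : LatinSquare n) : Set where
  field
    col       : Fin n → Fin n
    colInj    : Injective _≡_ _≡_ col
    symbolInj : Injective _≡_ _≡_ (λ r → LatinSquare.cell L r (col r))

SameTransversal : ∀ {n} {L : LatinSquare n} → Transversal L → Transversal L → Set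
SameTransversal t u = ∀ r → Transversal.col t r ≡ Transversal.col u r


-- The real bound  T ≤ (n / e^{2.117})^n  ⇔  T · e^{2.117 n} ≤ n^n.
-- Since e^x = Σ_{k≥0} x^k / k! with nonnegative terms, this holds iff
-- T · Σ_{k<K} x^k/k! ≤ n^n for every K, with x = 2.117 n = 2117 n / 1000.

pow-nz : ∀ b e → .{{NonZero b}} → NonZero (b ^ e)
pow-nz b zero = _
pow-nz b (suc e) {{nz}} = m*n≢0 b (b ^ e) {{nz}} {{pow-nz b e {{nz}}}}

expTerm : ℕ → ℕ → ℚ
expTerm n k = _/_ (ℤ.+ ((2117 * n) ^ k)) (1000 ^ k * (k !))
                  {{m*n≢0 (1000 ^ k) (k !) {{pow-nz 1000 k}} {{k !≢0}}}}

expPartial : ℕ → ℕ → ℚ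
expPartial n zero = 0ℚ
expPartial n (suc K) = expPartial n K +ℚ expTerm n K

BelowBound : ℕ → ℕ → Set
BelowBound n T = ∀ K → (ℤ.+ T / 1) *ℚ expPartial n K ≤ (ℤ.+ (n ^ n) / 1)

FewTransversals : ∀ {n} → LatinSquare n → Set
FewTransversals {n} L =
  ∀ (T : ℕ) (t : Fin T → Transversal L) →
    (∀ i j → SameTransversal (t i) (t j) → i ≡ j) →
    BelowBound n T

{-# OPTIONS --safe #-}
module Submission where

-- Write n = 3q.  On ℤ_q × ℤ₃ shift by one the symbols of the q × q block (0, 0).  Summing
-- row, column and symbol labels over a transversal shows, for q odd, that q divides the number
-- of its cells in that block, so this number is 0 or q.  Counting rows, columns and symbols of
-- each class mod 3 shows that the blocks (1, 1) and (2, 2) contain equally many cells.  Hence a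
-- transversal either avoids the diagonal blocks or lies inside them: at most 2n/3 cells of each
-- row are relevant.  For q even the unshifted square has no transversal at all.
--
-- The surviving transversals are counted by exposing them row by row in a random order.  With k
-- rows left, a row has about (2n/3)(k/n)² possible cells on average, as both the column and the
-- symbol of a cell must still be free.  The product of these averages is about (2n/3e²)ⁿ, and
-- 2 + log(3/2) > 2.117.  Instead of entropy, a family always has a member whose product of
-- choices is at least the size of the family; AM-GM and Markov's inequality bound that
-- product for a positive proportion of the orders.

open import Defs
open import Data.Bool using (if_then_else_)
open import Data.Fin using (Fin; zero; suc; toℕ; punchIn; punchOut; combine; remQuot; _↑ˡ_; _↑ʳ_)
open import Data.Fin.Properties using (_≟_; all?; toℕ<n; toℕ-injective; toℕ-fromℕ<; punchInᵢ≢i; punchIn-punchOut; punchOut-injective; remQuot-combine; combine-remQuot; combine-injective)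
import Data.Integer as ℤ
import Data.Integer.Properties as ℤ
open import Data.Nat hiding (_≟_)
open import Data.Nat.Divisibility using (_∣_; divides; n∣m*n; m∣m*n; ∣n⇒∣m*n; ∣m+n∣m⇒∣n)
open import Data.Nat.DivMod
open import Data.Nat.Properties renaming (_≟_ to _≟ℕ_)
open import Data.Nat.Tactic.RingSolver using (solve-∀)
open import Data.Product using (Σ; ∃; ∃!; _,_; _×_; proj₁; proj₂)
import Data.Rational as ℚ
import Data.Rational.Properties as ℚ
open import Data.Rational.Unnormalised as ℚᵘ using (mkℚᵘ; _≃_; *≡*; *≤*)
import Data.Rational.Unnormalised.Properties as ℚᵘ
open import Data.Sum using (_⊎_; inj₁; inj₂)
open import Data.Unit using (⊤; tt)
open import Function using (_∘_; id)
open import Function.Definitions using (Injective)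
open import Relation.Binary.PropositionalEquality
open import Relation.Nullary using (¬_; Dec; yes; no; contradiction; does; _×-dec_; ¬?)
open import Relation.Nullary.Decidable using (toWitness; decidable-stable)
open import Algebra.Properties.Semiring.Sum +-*-semiring
  using (sum; sum-syntax; sum-remove; ∑-distrib-+; ∑-comm; sum-cong-≗; *-distribˡ-sum; *-distribʳ-sum)

open LatinSquare
open Transversal

private variable
  n : ℕ


-- Finite sums and indicator functions.

sum-mono-≤ : {f g : Fin n → ℕ} → (∀ i → f i ≤ g i) → sum f ≤ sum g
sum-mono-≤ {zero}  f≤g = z≤n
sum-mono-≤ {suc n} f≤g = +-mono-≤ (f≤g zero) (sum-mono-≤ (f≤g ∘ suc))

sum-const : ∀ n x → ∑[ i < n ] x ≡ n * x
sum-const zero    x = refl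
sum-const (suc n) x = cong (x +_) (sum-const n x)

sum-zero : {f : Fin n → ℕ} → (∀ i → f i ≡ 0) → sum f ≡ 0
sum-zero {n} f≡0 = trans (sum-cong-≗ f≡0) (trans (sum-const n 0) (*-zeroʳ n))

term≤sum : (f : Fin n → ℕ) → ∀ i → f i ≤ sum f
term≤sum {suc n} f i = ≤-trans (m≤m+n (f i) _) (≤-reflexive (sym (sum-remove {i = i} f)))

sum≡0⇒term≡0 : (f : Fin n → ℕ) → sum f ≡ 0 → ∀ i → f i ≡ 0
sum≡0⇒term≡0 f eq i = n≤0⇒n≡0 (≤-trans (term≤sum f i) (≤-reflexive eq))

-- An injective self-map of `Fin n` is a permutation: the term at `π zero` is split off, and
-- `punchOut` renumbers the other values so that induction applies to a smaller self-map.
sum-reindex : (f : Fin n → ℕ) {π : Fin n → Fin n} → Injective _≡_ _≡_ π → sum (f ∘ π) ≡ sum f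
sum-reindex {zero}  f         inj = refl
sum-reindex {suc n} f {π = π} inj = begin
  f k + sum (f ∘ π ∘ suc)         ≡⟨ cong (f k +_) (sum-cong-≗ λ j → cong f (sym (punchIn-punchOut (k≢ j)))) ⟩
  f k + sum (f ∘ punchIn k ∘ π′)  ≡⟨ cong (f k +_) (sum-reindex (f ∘ punchIn k) π′-inj) ⟩
  f k + sum (f ∘ punchIn k)       ≡⟨ sum-remove {i = k} f ⟨
  sum f                           ∎
  where
  open ≡-Reasoning
  k = π zero
  k≢ : ∀ j → k ≢ π (suc j)
  k≢ j eq with () ← inj eq
  π′ : Fin n → Fin n
  π′ j = punchOut (k≢ j)
  π′-inj : Injective _≡_ _≡_ π′
  π′-inj {i} {j} eq with refl ← inj (punchOut-injective (k≢ i) (k≢ j) eq) = refl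

𝟙 : {P : Set} → Dec P → ℕ
𝟙 d = if does d then 1 else 0

𝟙-true : {P : Set} (d : Dec P) → P → 𝟙 d ≡ 1
𝟙-true (yes _) p = refl
𝟙-true (no ¬p) p = contradiction p ¬p

𝟙-false : {P : Set} (d : Dec P) → ¬ P → 𝟙 d ≡ 0
𝟙-false (yes p) ¬p = contradiction p ¬p
𝟙-false (no _)  ¬p = refl

𝟙≢0⇒true : {P : Set} (d : Dec P) → 𝟙 d ≢ 0 → P
𝟙≢0⇒true (yes p) _   = p
𝟙≢0⇒true (no _)  0≢0 = contradiction refl 0≢0

𝟙-×-dec : {P Q : Set} (d : Dec P) (e : Dec Q) → 𝟙 (d ×-dec e) ≡ 𝟙 d * 𝟙 e
𝟙-×-dec (yes _) (yes _) = refl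
𝟙-×-dec (yes _) (no _)  = refl
𝟙-×-dec (no _)  _       = refl

𝟙-mono : {P Q : Set} (d : Dec P) (e : Dec Q) → (P → Q) → 𝟙 d ≤ 𝟙 e
𝟙-mono (yes p) e P⇒Q = ≤-reflexive (sym (𝟙-true e (P⇒Q p)))
𝟙-mono (no _)  e P⇒Q = z≤n

sum-single : (f : Fin n → ℕ) (j : Fin n) → (∀ i → i ≢ j → f i ≡ 0) → sum f ≡ f j
sum-single {suc n} f j f≡0 = begin
  sum f                    ≡⟨ sum-remove {i = j} f ⟩
  f j + sum (f ∘ punchIn j) ≡⟨ cong (f j +_) (sum-zero λ i → f≡0 _ (punchInᵢ≢i j i)) ⟩
  f j + 0                  ≡⟨ +-identityʳ (f j) ⟩
  f j                      ∎
  where open ≡-Reasoning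

sum-δ : (j : Fin n) → ∑[ i < n ] 𝟙 (i ≟ j) ≡ 1
sum-δ j = trans (sum-single _ j (λ i → 𝟙-false (i ≟ j))) (𝟙-true (j ≟ j) refl)

sum≢0⇒∃ : (f : Fin n → ℕ) → sum f ≢ 0 → ∃ λ i → f i ≢ 0
sum≢0⇒∃ {zero}  f ≢0 = contradiction refl ≢0
sum≢0⇒∃ {suc n} f ≢0 with f zero in eq
... | suc _ = zero , λ f0≡0 → 1+n≢0 (trans (sym eq) f0≡0)
... | zero  with i , fi≢0 ← sum≢0⇒∃ (f ∘ suc) ≢0 = suc i , fi≢0

-- Surjectivity by counting: the indicator of `j` summed along `π` equals its plain sum, which is 1,
-- so some index hits `j`.
injective⇒preimage : {π : Fin n → Fin n} → Injective _≡_ _≡_ π → ∀ j → ∃ λ i → π i ≡ j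
injective⇒preimage {π = π} inj j
  with i , δ≢0 ← sum≢0⇒∃ (λ i → 𝟙 (π i ≟ j))
         (λ ≡0 → 0≢1+n (trans (sym ≡0) (trans (sum-reindex (λ i → 𝟙 (i ≟ j)) inj) (sum-δ j))))
  = i , 𝟙≢0⇒true (π i ≟ j) δ≢0

argmax : Fin n → (f : Fin n → ℕ) → ∃ λ i → ∀ j → f j ≤ f i
argmax {suc zero}    _ f = zero , λ { zero → ≤-refl }
argmax {suc (suc n)} _ f with argmax zero (f ∘ suc)
... | i , f≤ with ≤-total (f zero) (f (suc i))
...   | inj₁ 0≤i = suc i , λ { zero → 0≤i ; (suc j) → f≤ j }
...   | inj₂ i≤0 = zero , λ { zero → ≤-refl ; (suc j) → ≤-trans (f≤ j) i≤0 }

-- Powers, Bernoulli's inequality and the AM-GM step.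

^-distribʳ-* : ∀ k a b → (a * b) ^ k ≡ a ^ k * b ^ k
^-distribʳ-* zero    a b = refl
^-distribʳ-* (suc k) a b = trans (cong (a * b *_) (^-distribʳ-* k a b)) ([m*n]*[o*p]≡[m*o]*[n*p] a b (a ^ k) (b ^ k))

two-mul≤sq+sq : ∀ a b → 2 * (a * b) ≤ a * a + b * b
two-mul≤sq+sq a b with ≤-total a b
... | inj₁ a≤b with c , refl ← m≤n⇒∃[o]m+o≡n a≤b =
  ≤-trans (m≤m+n _ (c * c)) (≤-reflexive (identity a c))
  where
  identity : ∀ a c → 2 * (a * (a + c)) + c * c ≡ a * a + (a + c) * (a + c)
  identity = solve-∀
... | inj₂ b≤a with c , refl ← m≤n⇒∃[o]m+o≡n b≤a =
  ≤-trans (m≤m+n _ (c * c)) (≤-reflexive (identity b c))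
  where
  identity : ∀ b c → 2 * ((b + c) * b) + c * c ≡ (b + c) * (b + c) + b * b
  identity = solve-∀

-- Bernoulli's inequality (u/v)^(k+1) ≥ 1 + (k+1)(u/v − 1), cleared of denominators.
bernoulli : ∀ k u v → suc k * (u * v ^ k) ≤ u ^ suc k + k * v ^ suc k
bernoulli zero    u v = ≤-reflexive (identity u)
  where
  identity : ∀ u → 1 * (u * 1) ≡ u * 1 + 0
  identity = solve-∀
-- Adding `k * (u * v ^ suc k)` to both sides turns the left one into a multiple of `2 * (u * v)`,
-- ready for `two-mul≤sq+sq`.
bernoulli (suc k) u v = +-cancelʳ-≤ (k * (u * v ^ suc k)) _ _ (begin
  suc (suc k) * (u * (v * w)) + k * (u * (v * w))        ≡⟨ identity₁ k u v w ⟩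
  suc k * (2 * (u * v) * w)                              ≤⟨ *-monoʳ-≤ (suc k) (*-monoˡ-≤ w (two-mul≤sq+sq u v)) ⟩
  suc k * ((u * u + v * v) * w)                          ≡⟨ identity₂ k u v w ⟩
  u * (suc k * (u * w)) + suc k * (v * (v * w))          ≤⟨ +-monoˡ-≤ _ (*-monoʳ-≤ u (bernoulli k u v)) ⟩
  u * (u ^ suc k + k * (v * w)) + suc k * (v * (v * w))  ≡⟨ identity₃ k u v w (u ^ suc k) ⟩
  u * u ^ suc k + suc k * (v * (v * w)) + k * (u * (v * w)) ∎)
  where
  open ≤-Reasoning
  w = v ^ k
  identity₁ : ∀ k u v w → suc (suc k) * (u * (v * w)) + k * (u * (v * w)) ≡ suc k * (2 * (u * v) * w)
  identity₁ = solve-∀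
  identity₂ : ∀ k u v w → suc k * ((u * u + v * v) * w) ≡ u * (suc k * (u * w)) + suc k * (v * (v * w))
  identity₂ = solve-∀
  identity₃ : ∀ k u v w x → u * (x + k * (v * w)) + suc k * (v * (v * w)) ≡ u * x + suc k * (v * (v * w)) + k * (u * (v * w))
  identity₃ = solve-∀

-- Bernoulli's inequality at `u = k * (x + s)` and `v = suc k * s`, whose quotient compares the mean
-- of `k + 1` numbers with sum `x + s` to the mean of `k` numbers with sum `s`. It lets one more
-- number `x` join an AM-GM estimate.
am-gm-step : ∀ k x s → x * s ^ k * suc k ^ suc k ≤ k ^ k * (x + s) ^ suc k
am-gm-step zero      x s = ≤-trans (≤-reflexive (identity x)) (≤-trans (m≤m+n x s) (≤-reflexive (identity′ (x + s))))
  where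
  identity : ∀ x → x * 1 * 1 ≡ x
  identity = solve-∀
  identity′ : ∀ x → x ≡ 1 * (x * 1)
  identity′ = solve-∀
am-gm-step k@(suc _) x s = *-cancelˡ-≤ k (+-cancelʳ-≤ (k * v ^ suc k) _ _ (begin
  k * (x * s ^ k * suc k ^ suc k) + k * v ^ suc k       ≡⟨ cong (λ b → k * (x * σ * (suc k * κ)) + k * (v * b)) (^-distribʳ-* k (suc k) s) ⟩
  k * (x * σ * (suc k * κ)) + k * (suc k * s * (κ * σ)) ≡⟨ identity k x s σ κ ⟩
  suc k * (u * (κ * σ))                                 ≡⟨ cong (λ a → suc k * (u * a)) (^-distribʳ-* k (suc k) s) ⟨
  suc k * (u * v ^ k)                                   ≤⟨ bernoulli k u v ⟩
  u ^ suc k + k * v ^ suc k                             ≡⟨ cong (_+ k * v ^ suc k) (^-distribʳ-* (suc k) k (x + s)) ⟩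
  k ^ suc k * (x + s) ^ suc k + k * v ^ suc k           ≡⟨ cong (_+ k * v ^ suc k) (*-assoc k (k ^ k) _) ⟩
  k * (k ^ k * (x + s) ^ suc k) + k * v ^ suc k         ∎))
  where
  open ≤-Reasoning
  u = k * (x + s)
  v = suc k * s
  σ = s ^ k
  κ = suc k ^ k
  identity : ∀ k x s σ κ → k * (x * σ * (suc k * κ)) + k * (suc k * s * (κ * σ)) ≡ suc k * (k * (x + s) * (κ * σ))
  identity = solve-∀

-- Orders and sums over them.

-- Lehmer codes: (i , o) takes index i first and orders the others, renumbered along punchIn i, by o.
Order : ℕ → Set
Order zero    = ⊤
Order (suc n) = Fin (suc n) × Order n

sumₒ : ∀ n → (Order n → ℕ) → ℕ
sumₒ zero    F = F tt
sumₒ (suc n) F = ∑[ i < suc n ] sumₒ n (λ o → F (i , o))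

sumₒ-cong : ∀ n {F G : Order n → ℕ} → (∀ o → F o ≡ G o) → sumₒ n F ≡ sumₒ n G
sumₒ-cong zero    F≡G = F≡G tt
sumₒ-cong (suc n) F≡G = sum-cong-≗ λ i → sumₒ-cong n λ o → F≡G (i , o)

sumₒ-mono-≤ : ∀ n {F G : Order n → ℕ} → (∀ o → F o ≤ G o) → sumₒ n F ≤ sumₒ n G
sumₒ-mono-≤ zero    F≤G = F≤G tt
sumₒ-mono-≤ (suc n) F≤G = sum-mono-≤ λ i → sumₒ-mono-≤ n λ o → F≤G (i , o)

sumₒ-const : ∀ n x → sumₒ n (λ _ → x) ≡ n ! * x
sumₒ-const zero    x = sym (+-identityʳ x)
sumₒ-const (suc n) x = begin
  ∑[ i < suc n ] sumₒ n (λ _ → x) ≡⟨ sum-cong-≗ (λ (_ : Fin (suc n)) → sumₒ-const n x) ⟩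
  ∑[ i < suc n ] (n ! * x)        ≡⟨ sum-const (suc n) (n ! * x) ⟩
  suc n * (n ! * x)               ≡⟨ *-assoc (suc n) (n !) x ⟨
  suc n * n ! * x                 ∎
  where open ≡-Reasoning

sumₒ-distrib-+ : ∀ n (F G : Order n → ℕ) → sumₒ n (λ o → F o + G o) ≡ sumₒ n F + sumₒ n G
sumₒ-distrib-+ zero    F G = refl
sumₒ-distrib-+ (suc n) F G = trans
  (sum-cong-≗ λ i → sumₒ-distrib-+ n (λ o → F (i , o)) (λ o → G (i , o)))
  (∑-distrib-+ (λ i → sumₒ n λ o → F (i , o)) (λ i → sumₒ n λ o → G (i , o)))

sumₒ-distribˡ-* : ∀ n x (F : Order n → ℕ) → x * sumₒ n F ≡ sumₒ n (λ o → x * F o)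
sumₒ-distribˡ-* zero    x F = refl
sumₒ-distribˡ-* (suc n) x F = trans (*-distribˡ-sum x (λ i → sumₒ n λ o → F (i , o))) (sum-cong-≗ λ i → sumₒ-distribˡ-* n x (λ o → F (i , o)))

sumₒ-sum-comm : ∀ n {k} (F : Order n → Fin k → ℕ) → sumₒ n (λ o → sum (F o)) ≡ ∑[ i < k ] sumₒ n (λ o → F o i)
sumₒ-sum-comm zero    F = refl
sumₒ-sum-comm (suc n) F = trans
  (sum-cong-≗ λ i → sumₒ-sum-comm n (λ o → F (i , o)))
  (∑-comm λ i j → sumₒ n (λ o → F (i , o) j))

-- Three-index tensors and the removal of an index.

Tensor : ℕ → Set
Tensor n = Fin n → Fin n → Fin n → ℕ

record OffDiagonal (H : Tensor n) : Set where
  field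
    aac : ∀ a c → H a a c ≡ 0
    aba : ∀ a b → H a b a ≡ 0
    abb : ∀ a b → H a b b ≡ 0

open OffDiagonal

infixl 8 _↾_

_↾_ : Tensor (suc n) → Fin (suc n) → Tensor n
(H ↾ i) a b c = H (punchIn i a) (punchIn i b) (punchIn i c)

↾-offDiagonal : {H : Tensor (suc n)} → OffDiagonal H → ∀ i → OffDiagonal (H ↾ i)
↾-offDiagonal off i .aac a c = off .aac _ _
↾-offDiagonal off i .aba a c = off .aba _ _
↾-offDiagonal off i .abb a c = off .abb _ _

total : Tensor n → ℕ
total {n} H = ∑[ a < n ] ∑[ b < n ] ∑[ c < n ] H a b c

-- The three slices through `i` overlap only where two indices equal `i`; those entries vanish, so
-- no inclusion-exclusion correction is left.
total-remove : {H : Tensor (suc n)} → OffDiagonal H → ∀ i →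
  total H ≡ total (H ↾ i) + (∑[ b < suc n ] ∑[ c < suc n ] H i b c + (∑[ a < suc n ] ∑[ c < suc n ] H a i c + ∑[ a < suc n ] ∑[ b < suc n ] H a b i))
total-remove {n} {H} off i = begin
  total H
    ≡⟨ sum-remove {i = i} (λ a → ∑[ b < suc n ] ∑[ c < suc n ] H a b c) ⟩
  A + ∑[ a < n ] ∑[ b < suc n ] ∑[ c < suc n ] H (p a) b c
    ≡⟨ cong (A +_) (sum-cong-≗ λ a → sum-remove {i = i} (λ b → ∑[ c < suc n ] H (p a) b c)) ⟩
  A + ∑[ a < n ] (∑[ c < suc n ] H (p a) i c + ∑[ b < n ] ∑[ c < suc n ] H (p a) (p b) c)
    ≡⟨ cong (A +_) (∑-distrib-+ (λ a → ∑[ c < suc n ] H (p a) i c) _) ⟩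
  A + (∑[ a < n ] ∑[ c < suc n ] H (p a) i c + ∑[ a < n ] ∑[ b < n ] ∑[ c < suc n ] H (p a) (p b) c)
    ≡⟨ cong₂ (λ x y → A + (x + y)) B≡ (sum-cong-≗ λ a → trans (sum-cong-≗ λ b → sum-remove {i = i} (H (p a) (p b))) (∑-distrib-+ (λ b → H (p a) (p b) i) _)) ⟩
  A + (B + ∑[ a < n ] (∑[ b < n ] H (p a) (p b) i + ∑[ b < n ] ∑[ c < n ] H (p a) (p b) (p c)))
    ≡⟨ cong (λ x → A + (B + x)) (∑-distrib-+ (λ a → ∑[ b < n ] H (p a) (p b) i) _) ⟩
  A + (B + (∑[ a < n ] ∑[ b < n ] H (p a) (p b) i + total (H ↾ i)))
    ≡⟨ cong (λ x → A + (B + (x + total (H ↾ i)))) C≡ ⟩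
  A + (B + (C + total (H ↾ i)))
    ≡⟨ rearrange A B C (total (H ↾ i)) ⟩
  total (H ↾ i) + (A + (B + C)) ∎
  where
  open ≡-Reasoning
  p = punchIn i
  A = ∑[ b < suc n ] ∑[ c < suc n ] H i b c
  B = ∑[ a < suc n ] ∑[ c < suc n ] H a i c
  C = ∑[ a < suc n ] ∑[ b < suc n ] H a b i
  B≡ : ∑[ a < n ] ∑[ c < suc n ] H (p a) i c ≡ B
  B≡ = sym (trans (sum-remove {i = i} (λ a → ∑[ c < suc n ] H a i c)) (cong (_+ ∑[ a < n ] ∑[ c < suc n ] H (p a) i c) (sum-zero (off .aac i))))
  C≡ : ∑[ a < n ] ∑[ b < n ] H (p a) (p b) i ≡ C
  C≡ = sym (trans (sum-remove {i = i} (λ a → ∑[ b < suc n ] H a b i)) (cong₂ _+_ (sum-zero (off .aba i))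
    (sum-cong-≗ λ a → trans (sum-remove {i = i} (λ b → H (p a) b i)) (cong (_+ ∑[ b < n ] H (p a) (p b) i) (off .abb (p a) i)))))
  rearrange : ∀ A B C R → A + (B + (C + R)) ≡ R + (A + (B + C))
  rearrange = solve-∀

-- A triple of distinct indices survives exactly n − 3 of the n removals.
sum-total-↾ : {H : Tensor (suc n)} → OffDiagonal H → ∑[ i < suc n ] total (H ↾ i) + 3 * total H ≡ suc n * total H
sum-total-↾ {n} {H} off = begin
  R + 3 * t                                   ≡⟨ cong (λ x → R + (t + x)) (cong₂ (λ x y → x + (y + 0)) t≡B t≡C) ⟩
  R + (t + (ΣB + (ΣC + 0)))                   ≡⟨ cong (λ x → R + (t + (ΣB + x))) (+-identityʳ ΣC) ⟩
  R + (t + (ΣB + ΣC))                         ≡⟨ cong (λ x → R + (t + x)) (∑-distrib-+ B C) ⟨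
  R + (t + ∑[ i < suc n ] (B i + C i))        ≡⟨ cong (R +_) (∑-distrib-+ A (λ i → B i + C i)) ⟨
  R + ∑[ i < suc n ] (A i + (B i + C i))      ≡⟨ ∑-distrib-+ (λ i → total (H ↾ i)) (λ i → A i + (B i + C i)) ⟨
  ∑[ i < suc n ] (total (H ↾ i) + (A i + (B i + C i))) ≡⟨ sum-cong-≗ (λ i → sym (total-remove off i)) ⟩
  ∑[ i < suc n ] t                            ≡⟨ sum-const (suc n) t ⟩
  suc n * t                                   ∎
  where
  open ≡-Reasoning
  A B C : Fin (suc n) → ℕ
  A i = ∑[ b < suc n ] ∑[ c < suc n ] H i b c
  B i = ∑[ a < suc n ] ∑[ c < suc n ] H a i c
  C i = ∑[ a < suc n ] ∑[ b < suc n ] H a b i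
  t = total H
  R = ∑[ i < suc n ] total (H ↾ i)
  ΣB = sum B
  ΣC = sum C
  t≡B : t ≡ ΣB
  t≡B = ∑-comm λ a b → ∑[ c < suc n ] H a b c
  t≡C : t ≡ ΣC
  t≡C = trans (sum-cong-≗ λ a → ∑-comm (H a)) (∑-comm λ a c → ∑[ b < suc n ] H a b c)

-- Two indices leave no room for three distinct ones: the removal identity bounds `3 * total H` by
-- `2 * total H`.
total≡0 : {H : Tensor (suc n)} → suc n ≤ 2 → OffDiagonal H → total H ≡ 0
total≡0 {n} {H} n<2 off = n≤0⇒n≡0 (+-cancelʳ-≤ (2 * total H) (total H) 0 (begin
  3 * total H                                    ≤⟨ m≤n+m (3 * total H) (∑[ i < suc n ] total (H ↾ i)) ⟩
  ∑[ i < suc n ] total (H ↾ i) + 3 * total H     ≡⟨ sum-total-↾ off ⟩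
  suc n * total H                                ≤⟨ *-monoˡ-≤ (total H) n<2 ⟩
  2 * total H                                    ∎))
  where open ≤-Reasoning

-- Option counts along an order, AM-GM and averages.

options : Tensor n → Fin n → ℕ
-- The 1 is the cell of the transversal itself; the tensor will count the other cells of row `a`
-- that are still open.
options {n} H a = 1 + ∑[ b < n ] ∑[ c < n ] H a b c

optionsProduct : Tensor n → Order n → ℕ
optionsProduct {zero}  H _       = 1
optionsProduct {suc n} H (i , o) = options H i * optionsProduct (H ↾ i) o

-- With weights inversely proportional to the expected numbers of options the summands are about
-- equal on average, so AM-GM loses little in passing from `optionsProduct` to this sum.
score : (ℕ → ℕ) → Tensor n → Order n → ℕ
score {zero}  w H _       = 0
score {suc n} w H (i , o) = w (suc n) * options H i + score w (H ↾ i) o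

prodTo : (ℕ → ℕ) → ℕ → ℕ
prodTo w zero    = 1
prodTo w (suc n) = w (suc n) * prodTo w n

n^n≢0 : ∀ n → NonZero (n ^ n)
n^n≢0 zero    = _
n^n≢0 (suc n) = m^n≢0 (suc n) (suc n)

-- Induction on the number of factors: `am-gm-step` joins the first summand of the score to the `n`
-- later ones, and the common factor `n ^ n` cancels.
optionsProduct-am-gm : ∀ w (H : Tensor n) o → optionsProduct H o * prodTo w n * n ^ n ≤ score w H o ^ n
optionsProduct-am-gm {zero}  w H o       = ≤-refl
optionsProduct-am-gm {suc n} w H (i , o) = *-cancelˡ-≤ (n ^ n) {{n^n≢0 n}} (begin
  n ^ n * (x * p * (w (suc n) * ω) * suc n ^ suc n)  ≡⟨ identity (n ^ n) x p (w (suc n)) ω (suc n ^ suc n) ⟩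
  w (suc n) * x * (p * ω * n ^ n) * suc n ^ suc n    ≤⟨ *-monoˡ-≤ (suc n ^ suc n) (*-monoʳ-≤ (w (suc n) * x) (optionsProduct-am-gm w (H ↾ i) o)) ⟩
  w (suc n) * x * S ^ n * suc n ^ suc n              ≤⟨ am-gm-step n (w (suc n) * x) S ⟩
  n ^ n * (w (suc n) * x + S) ^ suc n                ∎)
  where
  open ≤-Reasoning
  x = options H i
  p = optionsProduct (H ↾ i) o
  ω = prodTo w n
  S = score w (H ↾ i) o
  identity : ∀ N x p v ω M → N * (x * p * (v * ω) * M) ≡ v * x * (p * ω * N) * M
  identity = solve-∀

-- For `n ≥ 3`, an entry at distinct `a`, `b`, `c` is counted in the orders that take `a` with `k`
-- indices left and `b`, `c` later; there are `(n - 3)! (k - 1) (k - 2)` of them. Weighted by `w k`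
-- they give at most `W (n - 3)!` for each of the `n - 2` values of `k` from 3 to `n`.
offWeight : ℕ → ℕ → ℕ
offWeight W (suc (suc k)) = W * k !
offWeight W _             = 0

module _ {w : ℕ → ℕ} {v W : ℕ} (w≤v : ∀ k → w k ≤ v) (w≤W : ∀ k → suc (suc k) * suc k * w (suc (suc (suc k))) ≤ W) where

  -- Taking one of `k + 3` indices costs at most `W * k !` per entry, and the removals keep `k`
  -- copies of each entry at `W * k !` each; together this is `W * suc k !`.
  offWeight-step : {H : Tensor (suc n)} → OffDiagonal H →
    n ! * w (suc n) * total H + offWeight W n * ∑[ i < suc n ] total (H ↾ i) ≤ offWeight W (suc n) * total H
  offWeight-step {zero} {H} off rewrite total≡0 (s≤s z≤n) off = ≤-reflexive (cong (_+ 0) (*-zeroʳ (1 * w 1)))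
  offWeight-step {suc zero} {H} off rewrite total≡0 (s≤s (s≤s z≤n)) off =
    ≤-trans (≤-reflexive (cong (_+ 0) (*-zeroʳ (1 * w 2)))) z≤n
  offWeight-step {suc (suc k)} {H} off = begin
    suc (suc k) ! * w (3 + k) * t + W * k ! * R    ≡⟨ cong (λ x → suc (suc k) ! * w (3 + k) * t + W * k ! * x) R≡ ⟩
    suc (suc k) ! * w (3 + k) * t + W * k ! * (k * t) ≡⟨ identity₁ k (k !) (w (3 + k)) t W ⟩
    (suc (suc k) * suc k * w (3 + k)) * (k ! * t) + W * k ! * (k * t) ≤⟨ +-monoˡ-≤ _ (*-monoˡ-≤ (k ! * t) (w≤W k)) ⟩
    W * (k ! * t) + W * k ! * (k * t)              ≡⟨ identity₂ k (k !) t W ⟩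
    W * (suc k !) * t                              ∎
    where
    open ≤-Reasoning
    t = total H
    R = ∑[ i < 3 + k ] total (H ↾ i)
    R≡ : R ≡ k * t
    R≡ = +-cancelʳ-≡ (3 * t) _ _ (trans (sum-total-↾ off) (trans (*-distribʳ-+ t 3 k) (+-comm (3 * t) (k * t))))
    identity₁ : ∀ k f w t W → suc (suc k) * (suc k * f) * w * t + W * f * (k * t) ≡ (suc (suc k) * suc k * w) * (f * t) + W * f * (k * t)
    identity₁ = solve-∀
    identity₂ : ∀ k f t W → W * (f * t) + W * f * (k * t) ≡ W * (suc k * f) * t
    identity₂ = solve-∀

  -- The first index is split off: summed over `i`, its alternatives amount to `total H`, and
  -- induction handles the restrictions. The always available choices cost at most `v` per stage,
  -- whence the first summand.
  sumₒ-score : {H : Tensor n} → OffDiagonal H → sumₒ n (score w H) ≤ n ! * n * v + offWeight W n * total H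
  sumₒ-score {zero}      off = z≤n
  sumₒ-score {suc n} {H} off = begin
    ∑[ i < suc n ] sumₒ n (λ o → w (suc n) * options H i + score w (H ↾ i) o)
      ≡⟨ sum-cong-≗ (λ i → trans (sumₒ-distrib-+ n (λ _ → w (suc n) * options H i) (score w (H ↾ i)))
           (cong₂ _+_ (sumₒ-const n (w (suc n) * options H i)) refl)) ⟩
    ∑[ i < suc n ] (n ! * (w (suc n) * options H i) + sumₒ n (score w (H ↾ i)))
      ≤⟨ sum-mono-≤ (λ i → +-monoʳ-≤ (n ! * (w (suc n) * options H i)) (sumₒ-score (↾-offDiagonal off i))) ⟩
    ∑[ i < suc n ] (n ! * (w (suc n) * options H i) + (n ! * n * v + offWeight W n * total (H ↾ i)))
      ≡⟨ sum-cong-≗ (λ i → identity₁ (n !) (w (suc n)) (h i) (n ! * n * v) (offWeight W n * total (H ↾ i))) ⟩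
    ∑[ i < suc n ] ((n ! * w (suc n) + n ! * n * v) + (n ! * w (suc n) * h i + offWeight W n * total (H ↾ i)))
      ≡⟨ trans (∑-distrib-+ (λ (_ : Fin (suc n)) → n ! * w (suc n) + n ! * n * v) (λ i → n ! * w (suc n) * h i + offWeight W n * total (H ↾ i)))
           (cong₂ _+_ (sum-const (suc n) (n ! * w (suc n) + n ! * n * v)) (∑-distrib-+ (λ i → n ! * w (suc n) * h i) (λ i → offWeight W n * total (H ↾ i)))) ⟩
    suc n * (n ! * w (suc n) + n ! * n * v) + ((∑[ i < suc n ] (n ! * w (suc n) * h i)) + (∑[ i < suc n ] (offWeight W n * total (H ↾ i))))
      ≡⟨ cong₂ (λ x y → suc n * (n ! * w (suc n) + n ! * n * v) + (x + y)) (sym (*-distribˡ-sum (n ! * w (suc n)) h)) (sym (*-distribˡ-sum (offWeight W n) (λ i → total (H ↾ i)))) ⟩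
    suc n * (n ! * w (suc n) + n ! * n * v) + (n ! * w (suc n) * total H + offWeight W n * ∑[ i < suc n ] total (H ↾ i))
      ≤⟨ +-mono-≤ (*-monoʳ-≤ (suc n) (+-monoˡ-≤ (n ! * n * v) (*-monoʳ-≤ (n !) (w≤v (suc n))))) (offWeight-step off) ⟩
    suc n * (n ! * v + n ! * n * v) + offWeight W (suc n) * total H
      ≡⟨ cong (_+ offWeight W (suc n) * total H) (identity₂ n (n !) v) ⟩
    suc n ! * suc n * v + offWeight W (suc n) * total H ∎
    where
    open ≤-Reasoning
    h : Fin (suc n) → ℕ
    h i = ∑[ b < suc n ] ∑[ c < suc n ] H i b c
    identity₁ : ∀ f w h x y → f * (w * (1 + h)) + (x + y) ≡ (f * w + x) + (f * w * h + y)
    identity₁ = solve-∀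
    identity₂ : ∀ n f v → suc n * (f * v + f * n * v) ≡ suc n * f * suc n * v
    identity₂ = solve-∀

-- Exposing a family of transversals in a fixed order.

row-injective : (L : LatinSquare n) → ∀ r {c c′} → cell L r c ≡ cell L r c′ → c ≡ c′
row-injective L r {c} {c′} eq with _ , _ , unique ← rowLatin L r (cell L r c′) = trans (sym (unique eq)) (unique refl)

col-injective : (L : LatinSquare n) → ∀ c {r r′} → cell L r c ≡ cell L r′ c → r ≡ r′
col-injective L c {r} {r′} eq with _ , _ , unique ← colLatin L c (cell L r′ c) = trans (sym (unique eq)) (unique refl)

-- Proportional to the expected number of options with k indices left; the shift s absorbs
-- the choice that is always available.
weight : ℕ → ℕ → ℕ
weight s k = (k + s) * (k + s)

size : ∀ {T} {P : Fin T → Set} → (∀ i → Dec (P i)) → ℕ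
size P? = sum λ i → 𝟙 (P? i)

_∘³_ : ∀ {k} → Tensor n → (Fin k → Fin n) → Tensor k
(H ∘³ e) a b c = H (e a) (e b) (e c)

-- Invariant of the exposure: the current members agree outside the rows enumerated by `e`. Once
-- they also agree in row `e a`, that row may be dropped from the enumeration.
agree-punchIn : ∀ {k m} (e : Fin (suc k) → Fin n) (a : Fin (suc k)) {f g : Fin n → Fin m} → f (e a) ≡ g (e a) →
  ∀ {x} → (∃ λ b → e b ≡ x) ⊎ f x ≡ g x → (∃ λ b → e (punchIn a b) ≡ x) ⊎ f x ≡ g x
agree-punchIn e a same (inj₂ eq)         = inj₂ eq
agree-punchIn e a same (inj₁ (b , refl)) with a ≟ b
... | yes refl = inj₂ same
... | no a≢b   = inj₁ (punchOut a≢b , cong e (punchIn-punchOut a≢b))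

module Restricted (L : LatinSquare n) {Allowed : Fin n → Fin n → Set} (allowed? : ∀ r c → Dec (Allowed r c)) where

  symbol : Transversal L → Fin n → Fin n
  symbol t r = cell L r (col t r)

  -- Column col t p is an alternative choice for row r which t blocks
  -- only through its cells in rows p and q.
  Available : Transversal L → (r p q : Fin n) → Set
  Available t r p q = (r ≢ p × r ≢ q × p ≢ q) × Allowed r (col t p) × symbol t q ≡ cell L r (col t p)

  available? : ∀ t r p q → Dec (Available t r p q)
  available? t r p q = (¬? (r ≟ p) ×-dec ¬? (r ≟ q) ×-dec ¬? (p ≟ q)) ×-dec allowed? r (col t p) ×-dec (symbol t q ≟ cell L r (col t p))

  alternatives : Transversal L → Tensor n
  alternatives t r p q = 𝟙 (available? t r p q)

  alternatives-offDiagonal : ∀ t → OffDiagonal (alternatives t)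
  alternatives-offDiagonal t = record
    { aac = λ a c → 𝟙-false (available? t a a c) λ ((a≢a , _) , _) → a≢a refl
    ; aba = λ a b → 𝟙-false (available? t a b a) λ ((_ , a≢a , _) , _) → a≢a refl
    ; abb = λ a b → 𝟙-false (available? t a b b) λ ((_ , _ , b≢b) , _) → b≢b refl
    }

  -- For fixed `r` and `p` the symbol of the cell determines `q`, and as `p` varies `col t p` takes
  -- every value once. So row `r` has at most as many alternatives as allowed cells.
  total-alternatives : ∀ {d} → (∀ r → ∑[ c < n ] 𝟙 (allowed? r c) ≤ d) → ∀ t → total (alternatives t) ≤ n * d
  total-alternatives {d} allowed≤d t = ≤-trans (sum-mono-≤ row≤d) (≤-reflexive (sum-const n d))
    where
    open ≤-Reasoning
    cell≤ : ∀ r p → ∑[ q < n ] 𝟙 (available? t r p q) ≤ 𝟙 (allowed? r (col t p))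
    cell≤ r p with q₀ , eq ← injective⇒preimage (symbolInj t) (cell L r (col t p)) = begin
      ∑[ q < n ] 𝟙 (available? t r p q)
        ≤⟨ sum-mono-≤ (λ q → ≤-trans
             (𝟙-mono (available? t r p q) (allowed? r (col t p) ×-dec (q ≟ q₀)) λ (_ , al , s) → al , symbolInj t (trans s (sym eq)))
             (≤-reflexive (𝟙-×-dec (allowed? r (col t p)) (q ≟ q₀)))) ⟩
      ∑[ q < n ] (𝟙 (allowed? r (col t p)) * 𝟙 (q ≟ q₀))  ≡⟨ *-distribˡ-sum (𝟙 (allowed? r (col t p))) (λ q → 𝟙 (q ≟ q₀)) ⟨
      𝟙 (allowed? r (col t p)) * ∑[ q < n ] 𝟙 (q ≟ q₀)    ≡⟨ cong (𝟙 (allowed? r (col t p)) *_) (sum-δ q₀) ⟩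
      𝟙 (allowed? r (col t p)) * 1                        ≡⟨ *-identityʳ _ ⟩
      𝟙 (allowed? r (col t p))                            ∎
    row≤d : ∀ r → ∑[ p < n ] ∑[ q < n ] alternatives t r p q ≤ d
    row≤d r = begin
      ∑[ p < n ] ∑[ q < n ] alternatives t r p q  ≤⟨ sum-mono-≤ (cell≤ r) ⟩
      ∑[ p < n ] 𝟙 (allowed? r (col t p))         ≡⟨ sum-reindex (λ c → 𝟙 (allowed? r c)) (colInj t) ⟩
      ∑[ c < n ] 𝟙 (allowed? r c)                 ≤⟨ allowed≤d r ⟩
      d                                           ∎

  module Family {T} (t : Fin T → Transversal L) (distinct : ∀ i j → SameTransversal (t i) (t j) → i ≡ j) where

    size-partition : {P : Fin T → Set} (P? : ∀ i → Dec (P i)) (r : Fin n) →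
      ∑[ c < n ] size (λ i → P? i ×-dec (c ≟ col (t i) r)) ≡ size P?
    size-partition P? r = trans (∑-comm λ c i → 𝟙 (P? i ×-dec (c ≟ col (t i) r))) (sum-cong-≗ λ i → begin
      ∑[ c < n ] 𝟙 (P? i ×-dec (c ≟ col (t i) r))      ≡⟨ sum-cong-≗ (λ c → 𝟙-×-dec (P? i) (c ≟ col (t i) r)) ⟩
      ∑[ c < n ] (𝟙 (P? i) * 𝟙 (c ≟ col (t i) r))      ≡⟨ *-distribˡ-sum (𝟙 (P? i)) (λ c → 𝟙 (c ≟ col (t i) r)) ⟨
      𝟙 (P? i) * ∑[ c < n ] 𝟙 (c ≟ col (t i) r)        ≡⟨ cong (𝟙 (P? i) *_) (sum-δ (col (t i) r)) ⟩
      𝟙 (P? i) * 1                                     ≡⟨ *-identityʳ _ ⟩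
      𝟙 (P? i)                                         ∎)
      where open ≡-Reasoning

    -- Follow, row by row, the most popular column of the members still agreeing.
    ∃-size≤optionsProduct : ∀ {k} (e : Fin k → Fin n) (o : Order k) {P : Fin T → Set} (P? : ∀ i → Dec (P i)) →
      (∀ i → P i → ∀ r → Allowed r (col (t i) r)) →
      (∀ i j → P i → P j → ∀ x → (∃ λ a → e a ≡ x) ⊎ col (t i) x ≡ col (t j) x) →
      size P? ≢ 0 → ∃ λ i → P i × size P? ≤ optionsProduct (alternatives (t i) ∘³ e) o
    ∃-size≤optionsProduct {zero} e o {P} P? allowed agree size≢0
      with i , Pi≢0 ← sum≢0⇒∃ (λ i → 𝟙 (P? i)) size≢0 =
      i , Pi , (begin
        -- With no row left to expose the members agree everywhere, and distinctness leaves only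
        -- `i`.
        size P?                ≤⟨ sum-mono-≤ (λ j → 𝟙-mono (P? j) (j ≟ i) λ Pj → distinct j i (same j Pj)) ⟩
        ∑[ j < T ] 𝟙 (j ≟ i)   ≡⟨ sum-δ i ⟩
        1                      ∎)
      where
      open ≤-Reasoning
      Pi = 𝟙≢0⇒true (P? i) Pi≢0
      same : ∀ j → P j → SameTransversal (t j) (t i)
      same j Pj x with inj₂ eq ← agree j i Pj Pi x = eq
    ∃-size≤optionsProduct {suc k} e (a , o) {P} P? allowed agree size≢0
      -- `e a` serves here as an inhabitant of `Fin n`; `c₀` is the column used most often in row
      -- `e a`.
      with c₀ , f≤ ← argmax (e a) (λ c → size (λ i → P? i ×-dec (c ≟ col (t i) (e a))))
      with i , (Pi , c₀≡) , fc₀≤ ← ∃-size≤optionsProduct (e ∘ punchIn a) o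
             (λ i → P? i ×-dec (c₀ ≟ col (t i) (e a)))
             (λ i (Pi , _) → allowed i Pi)
             (λ i j (Pi , i≡) (Pj , j≡) x → agree-punchIn e a (trans (sym i≡) j≡) (agree i j Pi Pj x))
             (λ fc₀≡0 → size≢0 (trans (sym (size-partition P? (e a)))
                (sum-zero λ c → n≤0⇒n≡0 (≤-trans (f≤ c) (≤-reflexive fc₀≡0))))) =
      i , Pi , (begin
        size P?                                                    ≡⟨ size-partition P? r ⟨
        ∑[ c < n ] f c                                             ≡⟨ sum-reindex f (colInj (t i)) ⟨
        ∑[ x < n ] f (col (t i) x)                                 ≤⟨ sum-mono-≤ pointwise ⟩
        ∑[ x < n ] (f c₀ * g x)                                    ≡⟨ *-distribˡ-sum (f c₀) g ⟨
        f c₀ * ∑[ x < n ] g x                                      ≡⟨ cong (f c₀ *_) sum-g ⟩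
        f c₀ * options (H ∘³ e) a                                  ≡⟨ *-comm (f c₀) _ ⟩
        options (H ∘³ e) a * f c₀                                  ≤⟨ *-monoʳ-≤ (options (H ∘³ e) a) fc₀≤ ⟩
        options (H ∘³ e) a * optionsProduct (H ∘³ (e ∘ punchIn a)) o  ∎)
      where
      open ≤-Reasoning
      r = e a
      H = alternatives (t i)
      f : Fin n → ℕ
      f c = size (λ i → P? i ×-dec (c ≟ col (t i) r))
      h : Fin (suc k) → ℕ
      h b = ∑[ c < suc k ] H r (e b) (e c)
      -- `g x` counts the options of member `i` in the column of its row `x`: its own cell if `x` is
      -- `r`, otherwise the alternatives through that column.
      g : Fin n → ℕ
      g x = 𝟙 (x ≟ r) + ∑[ b < suc k ] (𝟙 (x ≟ e b) * h b)
      sum-g : ∑[ x < n ] g x ≡ options (H ∘³ e) a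
      sum-g = trans (∑-distrib-+ (λ x → 𝟙 (x ≟ r)) _) (cong₂ _+_ (sum-δ r)
        (trans (∑-comm λ x b → 𝟙 (x ≟ e b) * h b) (sum-cong-≗ λ b →
          trans (sym (*-distribʳ-sum (h b) λ x → 𝟙 (x ≟ e b))) (trans (cong (_* h b) (sum-δ (e b))) (*-identityˡ (h b))))))
      -- The row where `t i` has the symbol of `t j` in row `r` is not yet exposed: in an exposed
      -- row `t j` would have that symbol too, but it has it only in row `r = e a`.
      member : ∀ j → P j → ∀ y → symbol (t i) y ≡ symbol (t j) r → ∃ λ c → e c ≡ y
      member j Pj y sy with agree i j Pi Pj y
      ... | inj₁ y∈e = y∈e
      ... | inj₂ eq  = a , sym (symbolInj (t j) (trans (cong (cell L y) (sym eq)) sy))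
      -- The three rows are distinct by the Latin property: `r = y` would repeat the symbol in row
      -- `r`, and `x = y` in column `col (t i) x`.
      available : ∀ x j → P j → x ≢ r → col (t i) x ≡ col (t j) r → ∀ y → symbol (t i) y ≡ symbol (t j) r → Available (t i) r x y
      available x j Pj x≢r xj y sy =
        ( (λ r≡x → x≢r (sym r≡x))
        , (λ { refl → x≢r (colInj (t i) (row-injective L r (trans (cong (cell L r) xj) (sym sy)))) })
        , (λ { refl → x≢r (col-injective L (col (t i) x) (trans sy (cong (cell L r) (sym xj)))) }))
        , subst (Allowed r) (sym xj) (allowed j Pj r)
        , trans sy (cong (cell L r) (sym xj))
      1≤g : ∀ x j → P j → col (t i) x ≡ col (t j) r → 1 ≤ g x
      1≤g x j Pj xj with x ≟ r
      ... | yes _  = s≤s z≤n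
      ... | no x≢r with agree i j Pi Pj x
      ...   | inj₂ eq         = contradiction (colInj (t j) (trans (sym eq) xj)) x≢r
      ...   | inj₁ (b , refl)
              with y , sy ← injective⇒preimage (symbolInj (t i)) (symbol (t j) r)
              with c , refl ← member j Pj y sy = begin
        1                                            ≡⟨ 𝟙-true (available? (t i) r (e b) (e c)) (available (e b) j Pj x≢r xj (e c) sy) ⟨
        H r (e b) (e c)                              ≤⟨ term≤sum (λ c → H r (e b) (e c)) c ⟩
        h b                                          ≡⟨ trans (cong (_* h b) (𝟙-true (e b ≟ e b) refl)) (*-identityˡ (h b)) ⟨
        𝟙 (e b ≟ e b) * h b                          ≤⟨ term≤sum (λ b′ → 𝟙 (e b ≟ e b′) * h b′) b ⟩
        ∑[ b′ < suc k ] (𝟙 (e b ≟ e b′) * h b′)      ∎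
      -- A column used by no member contributes nothing; any other one is used by at most `f c₀`
      -- members and is an option, so `g x` is at least 1.
      pointwise : ∀ x → f (col (t i) x) ≤ f c₀ * g x
      pointwise x with f (col (t i) x) in eq
      ... | zero  = z≤n
      ... | suc m with j , ≢0 ← sum≢0⇒∃ (λ j → 𝟙 (P? j ×-dec (col (t i) x ≟ col (t j) r))) (λ ≡0 → 1+n≢0 (trans (sym eq) ≡0))
                  with Pj , xj ← 𝟙≢0⇒true (P? j ×-dec (col (t i) x ≟ col (t j) r)) ≢0 = begin
        suc m         ≡⟨ eq ⟨
        f (col (t i) x) ≤⟨ f≤ (col (t i) x) ⟩
        f c₀          ≡⟨ *-identityʳ (f c₀) ⟨
        f c₀ * 1      ≤⟨ *-monoʳ-≤ (f c₀) (1≤g x j Pj xj) ⟩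
        f c₀ * g x    ∎

-- Averaging over all orders.

prodTo-∣ : ∀ f {k n} → suc k ≤ n → f (suc k) ∣ prodTo f n
prodTo-∣ f {k} {suc n} (s≤s k≤n) with m≤n⇒m<n∨m≡n k≤n
... | inj₁ k<n  = ∣n⇒∣m*n (f (suc n)) (prodTo-∣ f k<n)
... | inj₂ refl = m∣m*n (prodTo f n)

prodTo-* : ∀ f g {W} n → (∀ k → k < n → f (suc k) * g (suc k) ≡ W) → prodTo f n * prodTo g n ≡ W ^ n
prodTo-* f g zero    eq = refl
prodTo-* f g (suc n) eq = trans ([m*n]*[o*p]≡[m*o]*[n*p] (f (suc n)) (prodTo f n) (g (suc n)) (prodTo g n))
  (cong₂ _*_ (eq n ≤-refl) (prodTo-* f g n λ k k<n → eq k (m<n⇒m<1+n k<n)))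

prodTo≢0 : ∀ f n → (∀ k → NonZero (f k)) → NonZero (prodTo f n)
prodTo≢0 f zero    f≢0 = _
prodTo≢0 f (suc n) f≢0 = m*n≢0 (f (suc n)) (prodTo f n) {{f≢0 (suc n)}} {{prodTo≢0 f n f≢0}}

-- Markov's inequality for a uniformly random order: an order with `F o` above `θ` is paid for by
-- `F o`, any other by its indicator.
markov : ∀ n (F : Order n → ℕ) θ → θ * n ! ≤ θ * sumₒ n (λ o → 𝟙 (F o ≤? θ)) + sumₒ n F
markov n F θ = begin
  θ * n !                                                ≡⟨ *-comm θ (n !) ⟩
  n ! * θ                                                ≡⟨ sumₒ-const n θ ⟨
  sumₒ n (λ _ → θ)                                       ≤⟨ sumₒ-mono-≤ n (λ o → pointwise (F o ≤? θ)) ⟩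
  sumₒ n (λ o → θ * 𝟙 (F o ≤? θ) + F o)                  ≡⟨ sumₒ-distrib-+ n (λ o → θ * 𝟙 (F o ≤? θ)) F ⟩
  sumₒ n (λ o → θ * 𝟙 (F o ≤? θ)) + sumₒ n F             ≡⟨ cong (_+ sumₒ n F) (sumₒ-distribˡ-* n θ (λ o → 𝟙 (F o ≤? θ))) ⟨
  θ * sumₒ n (λ o → 𝟙 (F o ≤? θ)) + sumₒ n F             ∎
  where
  open ≤-Reasoning
  pointwise : ∀ {x} (d : Dec (x ≤ θ)) → θ ≤ θ * 𝟙 d + x
  pointwise (yes _) = ≤-trans (≤-reflexive (sym (*-identityʳ θ))) (m≤m+n (θ * 1) _)
  pointwise (no ≰)  = ≤-trans (<⇒≤ (≰⇒> ≰)) (m≤n+m _ (θ * 0))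

-- The main term is 200/300 of `n ! * W`, from `3 * d ≤ 2 * n`. Half of the remaining 1/300 covers
-- the always available choices, since `v * (600 * n) ≤ W`; the other half covers the quotient of
-- `n` by `n - 1`, since `400 * n ≤ 401 * (n - 1)`.
mean-score-bound : ∀ {n s d v W} → 401 ≤ n → 600 * n ≤ s * s → 3 * d ≤ 2 * n → v * (s * s) ≤ W →
  300 * (n ! * n * v + offWeight W n * (n * d)) ≤ 201 * (n ! * W)
mean-score-bound {suc zero} (s≤s ())
mean-score-bound {n@(suc (suc k))} {s} {d} {v} {W} 401≤n 600n≤s² 3d≤2n vs²≤W = *-cancelˡ-≤ 2 (begin
  2 * (300 * (n ! * n * v + W * k ! * (n * d)))                        ≡⟨ identity₁ (n !) n v (W * k !) d ⟩
  n ! * (v * (600 * n)) + 200 * n * (W * k !) * (3 * d)                ≤⟨ +-mono-≤ (*-monoʳ-≤ (n !) (≤-trans (*-monoʳ-≤ v 600n≤s²) vs²≤W)) (*-monoʳ-≤ (200 * n * (W * k !)) 3d≤2n) ⟩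
  n ! * W + 200 * n * (W * k !) * (2 * n)                              ≡⟨ cong (n ! * W +_) (identity₂ n W (k !)) ⟩
  n ! * W + n * (W * k !) * (400 * n)                                  ≤⟨ +-monoʳ-≤ (n ! * W) (*-monoʳ-≤ (n * (W * k !)) 400n≤) ⟩
  n ! * W + n * (W * k !) * (401 * suc k)                              ≡⟨ identity₃ k W (k !) ⟩
  2 * (201 * (n ! * W))                                                ∎)
  where
  open ≤-Reasoning
  400n≤ : 400 * n ≤ 401 * suc k
  400n≤ = +-cancelʳ-≤ 401 _ _ (≤-trans (+-monoʳ-≤ (400 * n) 401≤n) (≤-reflexive (identity k)))
    where
    identity : ∀ k → 400 * (2 + k) + (2 + k) ≡ 401 * suc k + 401
    identity = solve-∀
  identity₁ : ∀ f n v x d → 2 * (300 * (f * n * v + x * (n * d))) ≡ f * (v * (600 * n)) + 200 * n * x * (3 * d)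
  identity₁ = solve-∀
  identity₂ : ∀ n W f → 200 * n * (W * f) * (2 * n) ≡ n * (W * f) * (400 * n)
  identity₂ = solve-∀
  identity₃ : ∀ k W f → (2 + k) * (suc k * f) * W + (2 + k) * (W * f) * (401 * suc k) ≡ 2 * (201 * ((2 + k) * (suc k * f) * W))
  identity₃ = solve-∀

module _ (L : LatinSquare n) {Allowed : Fin n → Fin n → Set} (allowed? : ∀ r c → Dec (Allowed r c))
         {T} (t : Fin T → Transversal L) (distinct : ∀ i j → SameTransversal (t i) (t j) → i ≡ j)
         {P : Fin T → Set} (P? : ∀ i → Dec (P i)) (allowed : ∀ i → P i → ∀ r → Allowed r (col (t i) r))
         {s d : ℕ} .{{s≢0 : NonZero s}} (401≤n : 401 ≤ n) (600n≤s² : 600 * n ≤ s * s) (3d≤2n : 3 * d ≤ 2 * n)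
         (allowed≤d : ∀ r → ∑[ c < n ] 𝟙 (allowed? r c) ≤ d)
         where

  open Restricted L allowed?
  open Family t distinct

  private
    m : ℕ → ℕ
    m = weight s

    m≢0 : ∀ k → NonZero (m k)
    m≢0 k = m*n≢0 (k + s) (k + s) {{k+s≢0}} {{k+s≢0}}
      where
      k+s≢0 : NonZero (k + s)
      k+s≢0 = >-nonZero (≤-trans (>-nonZero⁻¹ s) (m≤n+m s k))

    W : ℕ
    W = prodTo m n

    W≢0 : NonZero W
    W≢0 = prodTo≢0 m n m≢0

    -- The weight is the reciprocal of the expected number of options, scaled by `W`. For
    -- `1 ≤ k ≤ n` the division is exact, as `m k` is a factor of `W`.
    w : ℕ → ℕ
    w k = _/_ W (m k) {{m≢0 k}}

    v : ℕ
    v = _/_ W (s * s) {{m≢0 0}}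

    w≤v : ∀ k → w k ≤ v
    w≤v k = /-monoʳ-≤ W {{m≢0 k}} {{m≢0 0}} (*-mono-≤ (m≤n+m s k) (m≤n+m s k))

    w≤W : ∀ k → (2 + k) * suc k * w (3 + k) ≤ W
    w≤W k = begin
      (2 + k) * suc k * w (3 + k)  ≤⟨ *-monoˡ-≤ (w (3 + k)) (*-mono-≤ (≤-trans (n≤1+n (2 + k)) (m≤m+n (3 + k) s)) (≤-trans (m≤n+m (suc k) 2) (m≤m+n (3 + k) s))) ⟩
      m (3 + k) * w (3 + k)        ≡⟨ *-comm (m (3 + k)) (w (3 + k)) ⟩
      w (3 + k) * m (3 + k)        ≤⟨ m/n*n≤m W (m (3 + k)) {{m≢0 (3 + k)}} ⟩
      W                            ∎
      where open ≤-Reasoning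

    prod-w : prodTo w n * W ≡ W ^ n
    prod-w = prodTo-* w m n λ k k<n → m/n*n≡m {{m≢0 (suc k)}} (prodTo-∣ m k<n)

    -- The cut-off 101/150 = 202/300 of `W` lies just above the bound 201/300 for the mean score, so
    -- Markov's inequality leaves each member at least one good order in 202.
    Good : Fin T → Order n → Set
    Good i o = 150 * score w (alternatives (t i)) o ≤ 101 * W

    good? : ∀ i o → Dec (Good i o)
    good? i o = 150 * score w (alternatives (t i)) o ≤? 101 * W

    many-good : ∀ i → n ! ≤ 202 * sumₒ n (λ o → 𝟙 (good? i o))
    many-good i = *-cancelˡ-≤ (101 * W) {{m*n≢0 101 W {{_}} {{W≢0}}}} (+-cancelʳ-≤ (201 * (101 * W * n !)) _ _ (begin
      θ * n ! + 201 * (θ * n !)                 ≡⟨⟩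
      202 * (θ * n !)                           ≤⟨ *-monoʳ-≤ 202 (markov n (λ o → 150 * score w H o) θ) ⟩
      202 * (θ * G + sumₒ n (λ o → 150 * score w H o)) ≡⟨ cong (λ x → 202 * (θ * G + x)) (sym (sumₒ-distribˡ-* n 150 (score w H))) ⟩
      202 * (θ * G + 150 * sumₒ n (score w H))  ≡⟨ identity₁ θ G (sumₒ n (score w H)) ⟩
      θ * (202 * G) + 101 * (300 * sumₒ n (score w H)) ≤⟨ +-monoʳ-≤ (θ * (202 * G)) (*-monoʳ-≤ 101 (begin
        300 * sumₒ n (score w H)                                      ≤⟨ *-monoʳ-≤ 300 (sumₒ-score w≤v w≤W (alternatives-offDiagonal (t i))) ⟩
        300 * (n ! * n * v + offWeight W n * total H)                 ≤⟨ *-monoʳ-≤ 300 (+-monoʳ-≤ (n ! * n * v) (*-monoʳ-≤ (offWeight W n) (total-alternatives allowed≤d (t i)))) ⟩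
        300 * (n ! * n * v + offWeight W n * (n * d))                 ≤⟨ mean-score-bound {n} {s} 401≤n 600n≤s² 3d≤2n (m/n*n≤m W (s * s) {{m≢0 0}}) ⟩
        201 * (n ! * W)                                               ∎)) ⟩
      θ * (202 * G) + 101 * (201 * (n ! * W))   ≡⟨ identity₂ (θ * (202 * G)) W (n !) ⟩
      θ * (202 * G) + 201 * (θ * n !)           ∎))
      where
      open ≤-Reasoning
      θ = 101 * W
      H = alternatives (t i)
      G = sumₒ n (λ o → 𝟙 (good? i o))
      identity₁ : ∀ θ G S → 202 * (θ * G + 150 * S) ≡ θ * (202 * G) + 101 * (300 * S)
      identity₁ = solve-∀
      identity₂ : ∀ x W f → x + 101 * (201 * (f * W)) ≡ x + 201 * (101 * W * f)
      identity₂ = solve-∀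

    -- AM-GM against the score: the weights multiply to `W ^ n / W`, so a single factor `W`, the
    -- product of the scaled expectations, survives.
    optionsProduct-bound : ∀ i o → Good i o → optionsProduct (alternatives (t i)) o * (150 * n) ^ n ≤ 101 ^ n * W
    optionsProduct-bound i o good = *-cancelˡ-≤ (W ^ n) {{m^n≢0 W n {{W≢0}}}} (begin
      W ^ n * (p * (150 * n) ^ n)                   ≡⟨ cong₂ (λ x y → x * (p * y)) (sym prod-w) (^-distribʳ-* n 150 n) ⟩
      ω * W * (p * (150 ^ n * n ^ n))               ≡⟨ identity₁ ω W p (150 ^ n) (n ^ n) ⟩
      150 ^ n * (p * ω * n ^ n) * W                 ≤⟨ *-monoˡ-≤ W (*-monoʳ-≤ (150 ^ n) (optionsProduct-am-gm w (alternatives (t i)) o)) ⟩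
      150 ^ n * score w (alternatives (t i)) o ^ n * W ≡⟨ cong (_* W) (^-distribʳ-* n 150 (score w (alternatives (t i)) o)) ⟨
      (150 * score w (alternatives (t i)) o) ^ n * W   ≤⟨ *-monoˡ-≤ W (^-monoˡ-≤ n good) ⟩
      (101 * W) ^ n * W                             ≡⟨ cong (_* W) (^-distribʳ-* n 101 W) ⟩
      101 ^ n * W ^ n * W                           ≡⟨ identity₂ (101 ^ n) (W ^ n) W ⟩
      W ^ n * (101 ^ n * W)                         ∎)
      where
      open ≤-Reasoning
      p = optionsProduct (alternatives (t i)) o
      ω = prodTo w n
      identity₁ : ∀ ω W p x y → ω * W * (p * (x * y)) ≡ x * (p * ω * y) * W
      identity₁ = solve-∀
      identity₂ : ∀ x y W → x * y * W ≡ y * (x * W)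
      identity₂ = solve-∀

    -- Only the members for which `o` is good are exposed. The member found is then itself good, so
    -- the bound on its product of options bounds the whole subfamily.
    size-good : ∀ o → size (λ i → P? i ×-dec good? i o) * (150 * n) ^ n ≤ 101 ^ n * W
    size-good o with size (λ i → P? i ×-dec good? i o) ≟ℕ 0
    ... | yes eq rewrite eq = z≤n
    ... | no ≢0
      with i , (_ , good) , size≤ ← ∃-size≤optionsProduct id o (λ i → P? i ×-dec good? i o)
             (λ i (Pi , _) → allowed i Pi) (λ _ _ _ _ x → inj₁ (x , refl)) ≢0 =
      ≤-trans (*-monoˡ-≤ ((150 * n) ^ n) size≤) (optionsProduct-bound i o good)

  -- Double counting of the pairs of a member and an order good for it: `many-good` counts by
  -- members, `size-good` by orders.
  transversal-count-bound : size P? * (150 * n) ^ n ≤ 202 * (101 ^ n * prodTo (weight s) n)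
  transversal-count-bound = *-cancelˡ-≤ (n !) {{n !≢0}} (begin
    n ! * (size P? * X)                                     ≡⟨ trans (sym (*-assoc (n !) (size P?) X)) (cong (_* X) (*-distribˡ-sum (n !) (λ i → 𝟙 (P? i)))) ⟩
    (∑[ i < T ] (n ! * 𝟙 (P? i))) * X                       ≤⟨ *-monoˡ-≤ X (sum-mono-≤ λ i → *-monoˡ-≤ (𝟙 (P? i)) (many-good i)) ⟩
    (∑[ i < T ] (202 * G i * 𝟙 (P? i))) * X                 ≡⟨ cong (_* X) (trans (sum-cong-≗ λ i → rearrange i) (sym (*-distribˡ-sum 202 (λ i → sumₒ n (λ o → 𝟙 (P? i ×-dec good? i o)))))) ⟩
    202 * (∑[ i < T ] sumₒ n (λ o → 𝟙 (P? i ×-dec good? i o))) * X ≡⟨ cong (λ x → 202 * x * X) (sumₒ-sum-comm n (λ o i → 𝟙 (P? i ×-dec good? i o))) ⟨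
    202 * sumₒ n N * X                                      ≡⟨ trans (*-assoc 202 (sumₒ n N) X) (cong (202 *_) (trans (*-comm (sumₒ n N) X) (sumₒ-distribˡ-* n X N))) ⟩
    202 * sumₒ n (λ o → X * N o)                            ≤⟨ *-monoʳ-≤ 202 (sumₒ-mono-≤ n λ o → ≤-trans (≤-reflexive (*-comm X (N o))) (size-good o)) ⟩
    202 * sumₒ n (λ _ → 101 ^ n * W)                        ≡⟨ cong (202 *_) (sumₒ-const n (101 ^ n * W)) ⟩
    202 * (n ! * (101 ^ n * W))                             ≡⟨ identity (n !) (101 ^ n * W) ⟩
    n ! * (202 * (101 ^ n * W))                             ∎)
    where
    open ≤-Reasoning
    X = (150 * n) ^ n
    G : Fin T → ℕ
    G i = sumₒ n (λ o → 𝟙 (good? i o))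
    N : Order n → ℕ
    N o = size (λ i → P? i ×-dec good? i o)
    rearrange : ∀ i → 202 * G i * 𝟙 (P? i) ≡ 202 * sumₒ n (λ o → 𝟙 (P? i ×-dec good? i o))
    rearrange i = trans (*-assoc 202 (G i) _) (cong (202 *_) (trans (*-comm (G i) (𝟙 (P? i)))
      (trans (sumₒ-distribˡ-* n (𝟙 (P? i)) (λ o → 𝟙 (good? i o))) (sumₒ-cong n λ o → sym (𝟙-×-dec (P? i) (good? i o))))))
    identity : ∀ f x → 202 * (f * x) ≡ f * (202 * x)
    identity = solve-∀

-- The shifted square on ℤ_q × ℤ₃ and its transversals.

sum-++ : ∀ m {n} (f : Fin (m + n) → ℕ) → sum f ≡ ∑[ i < m ] f (i ↑ˡ n) + ∑[ j < n ] f (m ↑ʳ j)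
sum-++ zero    f = refl
sum-++ (suc m) f = trans (cong (f zero +_) (sum-++ m (f ∘ suc))) (sym (+-assoc (f zero) _ _))

sum-combine : ∀ q {k} (f : Fin (q * k) → ℕ) → sum f ≡ ∑[ a < q ] ∑[ i < k ] f (combine a i)
sum-combine zero    f = refl
sum-combine (suc q) {k} f = trans (sum-++ k f) (cong (∑[ i < k ] f (i ↑ˡ (q * k)) +_) (sum-combine q (λ r → f (k ↑ʳ r))))

sum-toℕ : ∀ q → 2 * ∑[ a < q ] toℕ a + q ≡ q * q
sum-toℕ zero    = refl
sum-toℕ (suc q) = begin
  2 * ∑[ a < q ] suc (toℕ a) + suc q                    ≡⟨ cong (λ x → 2 * x + suc q) (∑-distrib-+ {q} (λ _ → 1) toℕ) ⟩
  2 * (∑[ a < q ] 1 + ∑[ a < q ] toℕ a) + suc q         ≡⟨ cong (λ x → 2 * (x + ∑[ a < q ] toℕ a) + suc q) (sum-const q 1) ⟩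
  2 * (q * 1 + ∑[ a < q ] toℕ a) + suc q                ≡⟨ identity₁ q (∑[ a < q ] toℕ a) ⟩
  2 * ∑[ a < q ] toℕ a + q + (2 * q + 1)                ≡⟨ cong (_+ (2 * q + 1)) (sum-toℕ q) ⟩
  q * q + (2 * q + 1)                                   ≡⟨ identity₂ q ⟩
  suc q * suc q                                         ∎
  where
  open ≡-Reasoning
  identity₁ : ∀ q x → 2 * (q * 1 + x) + suc q ≡ 2 * x + q + (2 * q + 1)
  identity₁ = solve-∀
  identity₂ : ∀ q → q * q + (2 * q + 1) ≡ suc q * suc q
  identity₂ = solve-∀

%-cancel : ∀ q .{{_ : NonZero q}} k {x y} → x < q → y < q → (k + x) % q ≡ (k + y) % q → x ≡ y
%-cancel q@(suc p) k {x} {y} x<q y<q eq = trans (sym (recover x<q)) (trans (cong (λ z → (z + (k * p) % q) % q) eq) (recover y<q))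
  where
  open ≡-Reasoning
  identity : ∀ k x p → k + x + k * p ≡ x + k * suc p
  identity = solve-∀
  -- Adding `k * p`, where `p = q - 1`, undoes the addition of `k` modulo `q`.
  recover : ∀ {x} → x < q → ((k + x) % q + (k * p) % q) % q ≡ x
  recover {x} x<q = begin
    ((k + x) % q + (k * p) % q) % q  ≡⟨ %-distribˡ-+ (k + x) (k * p) q ⟨
    (k + x + k * p) % q              ≡⟨ cong (_% q) (identity k x p) ⟩
    (x + k * q) % q                  ≡⟨ [m+kn]%n≡m%n x k q ⟩
    x % q                            ≡⟨ m<n⇒m%n≡m x<q ⟩
    x                                ∎

toℕ-mod : ∀ m q .{{_ : NonZero q}} → toℕ (m mod q) ≡ m % q
toℕ-mod m q = toℕ-fromℕ< (m%n<n m q)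

+-mod-injective : ∀ q .{{_ : NonZero q}} k {a b : Fin q} → (k + toℕ a) mod q ≡ (k + toℕ b) mod q → a ≡ b
+-mod-injective q k {a} {b} eq = toℕ-injective (%-cancel q k (toℕ<n a) (toℕ<n b)
  (trans (sym (toℕ-mod (k + toℕ a) q)) (trans (cong toℕ eq) (toℕ-mod (k + toℕ b) q))))

injective⇒∃! : {π : Fin n → Fin n} → Injective _≡_ _≡_ π → ∀ j → ∃! _≡_ (λ i → π i ≡ j)
injective⇒∃! inj j with i , eq ← injective⇒preimage inj j = i , eq , λ eq′ → inj (trans eq (sym eq′))

even⊎odd : ∀ q → ∃ (λ h → q ≡ h + h) ⊎ ∃ (λ h → q ≡ suc (h + h))
even⊎odd zero    = inj₁ (0 , refl)
even⊎odd (suc q) with even⊎odd q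
... | inj₁ (h , refl) = inj₂ (h , refl)
... | inj₂ (h , refl) = inj₁ (suc h , cong suc (sym (+-suc h h)))

infixl 6 _⊞_

_⊞_ : Fin 3 → Fin 3 → Fin 3
i ⊞ j = (toℕ i + toℕ j) mod 3

inBlock : Fin 3 → Fin 3 → Fin 3 → ℕ
inBlock k i j = 𝟙 ((i ≟ k) ×-dec (j ≟ k))

-- In ℤ₃, distinct `i`, `j` satisfy exactly one of `i = k`, `j = k`, `i + j = 2k`, while equal ones
-- satisfy all three or none. The 27 cases are evaluated.
block-identity : ∀ k i j → 𝟙 (i ≟ k) + 𝟙 (j ≟ k) + 𝟙 (i ⊞ j ≟ k ⊞ k) ≡ 3 * inBlock k i j + 𝟙 (¬? (i ≟ j))
block-identity = toWitness {a? = all? λ k → all? λ i → all? λ j →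
  𝟙 (i ≟ k) + 𝟙 (j ≟ k) + 𝟙 (i ⊞ j ≟ k ⊞ k) ≟ℕ 3 * inBlock k i j + 𝟙 (¬? (i ≟ j))} tt

sum-𝟙-≢ : ∀ k → ∑[ j < 3 ] 𝟙 (¬? (k ≟ j)) ≡ 2
sum-𝟙-≢ = toWitness {a? = all? λ k → ∑[ j < 3 ] 𝟙 (¬? (k ≟ j)) ≟ℕ 2} tt

sum-𝟙-≡ : ∀ k → ∑[ j < 3 ] 𝟙 (k ≟ j) ≡ 1
sum-𝟙-≡ = toWitness {a? = all? λ k → ∑[ j < 3 ] 𝟙 (k ≟ j) ≟ℕ 1} tt

-- δ shifts the symbols of the block (0, 0) of ℤ_q × ℤ₃.
module Square (q : ℕ) .{{_ : NonZero q}} (δ : ℕ) where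

  part : Fin (q * 3) → Fin q
  part r = proj₁ (remQuot {q} 3 r)

  class : Fin (q * 3) → Fin 3
  class r = proj₂ (remQuot {q} 3 r)

  combine-part-class : ∀ r → combine (part r) (class r) ≡ r
  combine-part-class = combine-remQuot {q} 3

  twist : Fin 3 → Fin 3 → ℕ
  twist i j = δ * inBlock zero i j

  entry : Fin (q * 3) → Fin (q * 3) → Fin (q * 3)
  entry r c = combine ((toℕ (part r) + toℕ (part c) + twist (class r) (class c)) mod q) (class r ⊞ class c)

  part-entry : ∀ r c → toℕ (part (entry r c)) ≡ (toℕ (part r) + toℕ (part c) + twist (class r) (class c)) % q
  part-entry r c = trans (cong (toℕ ∘ proj₁) (remQuot-combine ((toℕ (part r) + toℕ (part c) + twist (class r) (class c)) mod q) (class r ⊞ class c)))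
    (toℕ-mod (toℕ (part r) + toℕ (part c) + twist (class r) (class c)) q)

  class-entry : ∀ r c → class (entry r c) ≡ class r ⊞ class c
  class-entry r c = cong proj₂ (remQuot-combine ((toℕ (part r) + toℕ (part c) + twist (class r) (class c)) mod q) (class r ⊞ class c))

  ≡-from-coordinates : ∀ {r r′} → part r ≡ part r′ → class r ≡ class r′ → r ≡ r′
  ≡-from-coordinates {r} {r′} a≡ i≡ = trans (sym (combine-part-class r)) (trans (cong₂ combine a≡ i≡) (combine-part-class r′))

  entry-row-injective : ∀ r → Injective _≡_ _≡_ (entry r)
  entry-row-injective r {c} {c′} eq = ≡-from-coordinates b≡ j≡
    where
    parts = combine-injective _ (class r ⊞ class c) _ (class r ⊞ class c′) eq
    -- Classes come first because the twist depends on them alone; once they agree it is a common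
    -- summand of the parts.
    j≡ = +-mod-injective 3 (toℕ (class r)) (proj₂ parts)
    identity : ∀ a b g → a + b + g ≡ a + g + b
    identity = solve-∀
    b≡ = +-mod-injective q (toℕ (part r) + twist (class r) (class c)) (trans
      (cong (_mod q) (sym (identity (toℕ (part r)) (toℕ (part c)) _)))
      (trans (proj₁ parts) (cong (_mod q) (trans (identity (toℕ (part r)) (toℕ (part c′)) _)
        (cong (λ j → toℕ (part r) + twist (class r) j + toℕ (part c′)) (sym j≡))))))

  entry-comm : ∀ r c → entry r c ≡ entry c r
  entry-comm r c = cong₂ combine
    (cong (_mod q) (cong₂ _+_ (+-comm (toℕ (part r)) (toℕ (part c))) (cong (δ *_)
      (trans (𝟙-×-dec (class r ≟ zero) (class c ≟ zero)) (trans (*-comm (𝟙 (class r ≟ zero)) _) (sym (𝟙-×-dec (class c ≟ zero) (class r ≟ zero))))))))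
    (cong (_mod 3) (+-comm (toℕ (class r)) (toℕ (class c))))

  square : LatinSquare (q * 3)
  square = record
    { cell     = entry
    ; rowLatin = λ r → injective⇒∃! (entry-row-injective r)
    ; colLatin = λ c → injective⇒∃! λ {r} {r′} eq → entry-row-injective c (trans (entry-comm c r) (trans eq (entry-comm r′ c)))
    }

  sum-class : ∀ (f : Fin 3 → ℕ) → ∑[ r < q * 3 ] f (class r) ≡ q * ∑[ i < 3 ] f i
  sum-class f = begin
    ∑[ r < q * 3 ] f (class r)                     ≡⟨ sum-combine q (f ∘ class) ⟩
    ∑[ a < q ] ∑[ i < 3 ] f (class (combine a i))  ≡⟨ sum-cong-≗ {q} (λ a → sum-cong-≗ {3} λ i → cong (f ∘ proj₂) (remQuot-combine a i)) ⟩
    ∑[ a < q ] ∑[ i < 3 ] f i                      ≡⟨ sum-const q (∑[ i < 3 ] f i) ⟩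
    q * ∑[ i < 3 ] f i                             ∎
    where open ≡-Reasoning

  sum-part : 2 * ∑[ r < q * 3 ] toℕ (part r) + 3 * q ≡ 3 * (q * q)
  sum-part = begin
    2 * ∑[ r < q * 3 ] toℕ (part r) + 3 * q                      ≡⟨ cong (λ x → 2 * x + 3 * q) S≡ ⟩
    2 * (3 * ∑[ a < q ] toℕ a) + 3 * q                           ≡⟨ identity (∑[ a < q ] toℕ a) q ⟩
    3 * (2 * ∑[ a < q ] toℕ a + q)                               ≡⟨ cong (3 *_) (sum-toℕ q) ⟩
    3 * (q * q)                                                  ∎
    where
    open ≡-Reasoning
    identity : ∀ x q → 2 * (3 * x) + 3 * q ≡ 3 * (2 * x + q)
    identity = solve-∀
    S≡ : ∑[ r < q * 3 ] toℕ (part r) ≡ 3 * ∑[ a < q ] toℕ a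
    S≡ = begin
      ∑[ r < q * 3 ] toℕ (part r)                       ≡⟨ sum-combine q (toℕ ∘ part) ⟩
      ∑[ a < q ] ∑[ i < 3 ] toℕ (part (combine a i))    ≡⟨ sum-cong-≗ {q} (λ a → sum-cong-≗ {3} λ i → cong (toℕ ∘ proj₁) (remQuot-combine a i)) ⟩
      ∑[ a < q ] ∑[ i < 3 ] toℕ a                       ≡⟨ sum-cong-≗ {q} (λ a → sum-const 3 (toℕ a)) ⟩
      ∑[ a < q ] (3 * toℕ a)                            ≡⟨ *-distribˡ-sum {q} 3 toℕ ⟨
      3 * ∑[ a < q ] toℕ a                              ∎

  module _ (t : Transversal square) where

    blockCount : Fin 3 → ℕ
    blockCount k = ∑[ r < q * 3 ] inBlock k (class r) (class (col t r))

    offCount : ℕ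
    offCount = ∑[ r < q * 3 ] 𝟙 (¬? (class r ≟ class (col t r)))

    -- `block-identity` summed over the cells: a transversal meets every row, column and symbol
    -- once, and `q` of each lie in any given class.
    blockCount-identity : ∀ k → 3 * blockCount k + offCount ≡ 3 * q
    blockCount-identity k = begin
      3 * blockCount k + offCount
        ≡⟨ cong (_+ offCount) (*-distribˡ-sum 3 (λ r → inBlock k (class r) (class (col t r)))) ⟩
      ∑[ r < q * 3 ] (3 * inBlock k (class r) (class (col t r))) + offCount
        ≡⟨ ∑-distrib-+ (λ r → 3 * inBlock k (class r) (class (col t r))) (λ r → 𝟙 (¬? (class r ≟ class (col t r)))) ⟨
      ∑[ r < q * 3 ] (3 * inBlock k (class r) (class (col t r)) + 𝟙 (¬? (class r ≟ class (col t r))))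
        ≡⟨ sum-cong-≗ (λ r → sym (block-identity k (class r) (class (col t r)))) ⟩
      ∑[ r < q * 3 ] (𝟙 (class r ≟ k) + 𝟙 (class (col t r) ≟ k) + 𝟙 (class r ⊞ class (col t r) ≟ k ⊞ k))
        ≡⟨ ∑-distrib-+ (λ r → 𝟙 (class r ≟ k) + 𝟙 (class (col t r) ≟ k)) (λ r → 𝟙 (class r ⊞ class (col t r) ≟ k ⊞ k)) ⟩
      ∑[ r < q * 3 ] (𝟙 (class r ≟ k) + 𝟙 (class (col t r) ≟ k)) + ∑[ r < q * 3 ] 𝟙 (class r ⊞ class (col t r) ≟ k ⊞ k)
        ≡⟨ cong₂ _+_ (∑-distrib-+ (λ r → 𝟙 (class r ≟ k)) (λ r → 𝟙 (class (col t r) ≟ k))) (sum-cong-≗ λ r → cong (λ x → 𝟙 (x ≟ k ⊞ k)) (sym (class-entry r (col t r)))) ⟩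
      ∑[ r < q * 3 ] 𝟙 (class r ≟ k) + ∑[ r < q * 3 ] 𝟙 (class (col t r) ≟ k) + ∑[ r < q * 3 ] 𝟙 (class (entry r (col t r)) ≟ k ⊞ k)
        ≡⟨ cong₂ _+_ (cong₂ _+_ (line k) (trans (sum-reindex (λ c → 𝟙 (class c ≟ k)) (colInj t)) (line k)))
             (trans (sum-reindex (λ c → 𝟙 (class c ≟ k ⊞ k)) (symbolInj t)) (line (k ⊞ k))) ⟩
      q + q + q
        ≡⟨ identity q ⟩
      3 * q ∎
      where
      open ≡-Reasoning
      line : ∀ k → ∑[ r < q * 3 ] 𝟙 (class r ≟ k) ≡ q
      line k = trans (sum-class (λ i → 𝟙 (i ≟ k))) (trans (cong (q *_) (sum-δ k)) (*-identityʳ q))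
      identity : ∀ x → x + x + x ≡ 3 * x
      identity = solve-∀

    blockCount≡ : ∀ k → blockCount k ≡ blockCount zero
    blockCount≡ k = *-cancelˡ-≡ _ _ 3 (+-cancelʳ-≡ offCount _ _ (trans (blockCount-identity k) (sym (blockCount-identity zero))))

    -- Row parts, column parts and symbol parts all sum to `S`, while modulo `q` a symbol part is
    -- row part plus column part plus twist. One `S` cancels, and `Q` collects the quotients by `q`.
    part-sum : ∃ λ Q → ∑[ r < q * 3 ] toℕ (part r) + δ * blockCount zero ≡ Q * q
    part-sum = Q , +-cancelˡ-≡ S _ _ (begin
      S + (S + δ * blockCount zero)                       ≡⟨ +-assoc S S _ ⟨
      S + S + δ * blockCount zero                         ≡⟨ cong₂ _+_ (cong (S +_) (sym (sum-reindex (toℕ ∘ part) (colInj t)))) (*-distribˡ-sum δ (λ r → inBlock zero (class r) (class (col t r)))) ⟩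
      S + ∑[ r < q * 3 ] toℕ (part (col t r)) + ∑[ r < q * 3 ] twist (class r) (class (col t r))
                                                          ≡⟨ cong (_+ ∑[ r < q * 3 ] twist (class r) (class (col t r))) (∑-distrib-+ (toℕ ∘ part) (toℕ ∘ part ∘ col t)) ⟨
      ∑[ r < q * 3 ] (toℕ (part r) + toℕ (part (col t r))) + ∑[ r < q * 3 ] twist (class r) (class (col t r))
                                                          ≡⟨ ∑-distrib-+ (λ r → toℕ (part r) + toℕ (part (col t r))) (λ r → twist (class r) (class (col t r))) ⟨
      ∑[ r < q * 3 ] raw r                                ≡⟨ sum-cong-≗ (λ r → trans (m≡m%n+[m/n]*n (raw r) q) (cong (_+ raw r / q * q) (sym (part-entry r (col t r))))) ⟩
      ∑[ r < q * 3 ] (toℕ (part (entry r (col t r))) + raw r / q * q)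
                                                          ≡⟨ ∑-distrib-+ (λ r → toℕ (part (entry r (col t r)))) (λ r → raw r / q * q) ⟩
      ∑[ r < q * 3 ] toℕ (part (entry r (col t r))) + ∑[ r < q * 3 ] (raw r / q * q)
                                                          ≡⟨ cong₂ _+_ (sum-reindex (toℕ ∘ part) (symbolInj t)) (sym (*-distribʳ-sum q (λ r → raw r / q))) ⟩
      S + Q * q                                           ∎)
      where
      open ≡-Reasoning
      S = ∑[ r < q * 3 ] toℕ (part r)
      raw : Fin (q * 3) → ℕ
      raw r = toℕ (part r) + toℕ (part (col t r)) + twist (class r) (class (col t r))
      Q = ∑[ r < q * 3 ] (raw r / q)

-- With `S = Q * q`, dividing `2 * S + 3 * q = 3 * (q * q)` by `q` leaves `2 * Q + 3 = 6 * h`,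
-- impossible by parity.
even-no-transversal : ∀ q .{{_ : NonZero q}} h → q ≡ h + h → ¬ Transversal (Square.square q 0)
even-no-transversal q h q≡ t = even≢odd (3 * h) (Q + 1) (*-cancelʳ-≡ _ _ q (begin
  2 * (3 * h) * q                    ≡⟨ identity₁ q h ⟩
  3 * ((h + h) * q)                  ≡⟨ cong (λ x → 3 * (x * q)) q≡ ⟨
  3 * (q * q)                        ≡⟨ sum-part ⟨
  2 * S + 3 * q                      ≡⟨ cong (λ x → 2 * x + 3 * q) (trans (sym (+-identityʳ S)) S≡) ⟩
  2 * (Q * q) + 3 * q                ≡⟨ identity₂ Q q ⟩
  suc (2 * (Q + 1)) * q              ∎))
  where
  open ≡-Reasoning
  open Square q 0
  S = ∑[ r < q * 3 ] toℕ (part r)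
  Q = proj₁ (part-sum t)
  S≡ : S + 0 ≡ Q * q
  S≡ = proj₂ (part-sum t)
  identity₁ : ∀ q h → 2 * (3 * h) * q ≡ 3 * ((h + h) * q)
  identity₁ = solve-∀
  identity₂ : ∀ Q q → 2 * (Q * q) + 3 * q ≡ suc (2 * (Q + 1)) * q
  identity₂ = solve-∀

-- Here `S = 3 * h * q` is itself divisible by `q`, hence so is the block count `x`, and
-- `3 * x ≤ 3 * q` leaves 0 and `q`. The diagonal blocks have equal counts, so `x = 0` empties them
-- all and `x = q` leaves no cell outside.
odd-avoids⊎diagonal : ∀ q .{{_ : NonZero q}} h → q ≡ suc (h + h) → (t : Transversal (Square.square q 1)) → let open Square q 1 in
  (∀ r → class r ≢ class (col t r)) ⊎ (∀ r → class r ≡ class (col t r))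
odd-avoids⊎diagonal q h q≡ t = dichotomy (∣⇒0⊎self q∣x x≤q)
  where
  open Square q 1
  x = blockCount t zero
  S = ∑[ r < q * 3 ] toℕ (part r)
  S≡ : S ≡ 3 * h * q
  S≡ = *-cancelˡ-≡ _ _ 2 (+-cancelʳ-≡ (3 * q) _ _ (trans sum-part (trans (cong (λ y → 3 * (y * q)) q≡) (identity q h))))
    where
    identity : ∀ q h → 3 * (suc (h + h) * q) ≡ 2 * (3 * h * q) + 3 * q
    identity = solve-∀
  q∣x : q ∣ x
  q∣x with Q , eq ← part-sum t = ∣m+n∣m⇒∣n (subst (q ∣_) (sym (trans (cong (S +_) (sym (*-identityˡ x))) eq)) (n∣m*n Q)) (subst (q ∣_) (sym S≡) (n∣m*n (3 * h)))
  x≤q : x ≤ q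
  x≤q = *-cancelˡ-≤ 3 (≤-trans (m≤m+n (3 * x) (offCount t)) (≤-reflexive (blockCount-identity t zero)))
  ∣⇒0⊎self : q ∣ x → x ≤ q → x ≡ 0 ⊎ x ≡ q
  ∣⇒0⊎self (divides zero eq)          _   = inj₁ eq
  ∣⇒0⊎self (divides (suc zero) eq)    _   = inj₂ (trans eq (+-identityʳ q))
  ∣⇒0⊎self (divides (suc (suc c)) eq) x≤q = contradiction (≤-trans (≤-reflexive (sym eq)) x≤q)
    (<⇒≱ (≤-trans (m<m+n q (>-nonZero⁻¹ q)) (+-monoʳ-≤ q (m≤m+n q (c * q)))))
  dichotomy : x ≡ 0 ⊎ x ≡ q → (∀ r → class r ≢ class (col t r)) ⊎ (∀ r → class r ≡ class (col t r))
  dichotomy (inj₁ x≡0) = inj₁ λ r same → 0≢1+n (trans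
    (sym (sum≡0⇒term≡0 (λ r′ → inBlock (class r) (class r′) (class (col t r′))) (trans (blockCount≡ t (class r)) x≡0) r))
    (𝟙-true ((class r ≟ class r) ×-dec (class (col t r) ≟ class r)) (refl , sym same)))
  dichotomy (inj₂ x≡q) = inj₂ λ r → decidable-stable (class r ≟ class (col t r)) λ differ → 0≢1+n (trans
    (sym (sum≡0⇒term≡0 (λ r → 𝟙 (¬? (class r ≟ class (col t r)))) off≡0 r))
    (𝟙-true (¬? (class r ≟ class (col t r))) differ))
    where
    off≡0 : offCount t ≡ 0
    off≡0 = +-cancelˡ-≡ (3 * q) _ _ (trans (cong (λ y → 3 * y + offCount t) (sym x≡q)) (trans (blockCount-identity t zero) (sym (+-identityʳ (3 * q)))))

-- Estimates for the product of the weights.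

prodTo-weight-+ : ∀ s a b → prodTo (weight s) (b + a) ≤ prodTo (weight s) a * weight s (b + a) ^ b
prodTo-weight-+ s a zero    = ≤-reflexive (sym (*-identityʳ _))
prodTo-weight-+ s a (suc b) = begin
  w * prodTo (weight s) (b + a)                       ≤⟨ *-monoʳ-≤ w (prodTo-weight-+ s a b) ⟩
  w * (prodTo (weight s) a * weight s (b + a) ^ b)    ≤⟨ *-monoʳ-≤ w (*-monoʳ-≤ (prodTo (weight s) a) (^-monoˡ-≤ b (*-mono-≤ (n≤1+n (b + a + s)) (n≤1+n (b + a + s))))) ⟩
  w * (prodTo (weight s) a * w ^ b)                   ≡⟨ identity w (prodTo (weight s) a) (w ^ b) ⟩
  prodTo (weight s) a * (w * w ^ b)                   ∎
  where
  open ≤-Reasoning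
  w = weight s (suc b + a)
  identity : ∀ w x y → w * (x * y) ≡ x * (w * y)
  identity = solve-∀

-- Equal to `((j + 1) !)²`, the product of the block bounds in units of `s * s`.
blockConstant : ℕ → ℕ
blockConstant zero    = 1
blockConstant (suc j) = (2 + j) * (2 + j) * blockConstant j

-- The factors are cut into blocks of length `s`, and each is replaced by the last of its block,
-- which is `((i + 2) * s)²` in block `i`, counted from 0.
prodTo-weight-blocks : ∀ s j → prodTo (weight s) (s * j) ≤ (blockConstant j * (s * s) ^ j) ^ s
prodTo-weight-blocks s zero    rewrite *-zeroʳ s = ≤-reflexive (sym (^-zeroˡ s))
prodTo-weight-blocks s (suc j) = begin
  prodTo (weight s) (s * suc j)                                          ≡⟨ cong (prodTo (weight s)) (*-suc s j) ⟩
  prodTo (weight s) (s + s * j)                                          ≤⟨ prodTo-weight-+ s (s * j) s ⟩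
  prodTo (weight s) (s * j) * weight s (s + s * j) ^ s                   ≤⟨ *-monoˡ-≤ (weight s (s + s * j) ^ s) (prodTo-weight-blocks s j) ⟩
  (blockConstant j * (s * s) ^ j) ^ s * weight s (s + s * j) ^ s         ≡⟨ ^-distribʳ-* s (blockConstant j * (s * s) ^ j) (weight s (s + s * j)) ⟨
  (blockConstant j * (s * s) ^ j * weight s (s + s * j)) ^ s             ≡⟨ cong (_^ s) (identity s j (blockConstant j) ((s * s) ^ j)) ⟩
  ((2 + j) * (2 + j) * blockConstant j * ((s * s) * (s * s) ^ j)) ^ s    ∎
  where
  open ≤-Reasoning
  identity : ∀ s j c x → c * x * ((s + s * j + s) * (s + s * j + s)) ≡ (2 + j) * (2 + j) * c * ((s * s) * x)
  identity = solve-∀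

-- With N = sJ + ρ, each block of s consecutive factors gains the constant factor 2 of
-- the first hypothesis, which pays for the ρ leftover factors.
exponential-gain : ∀ {A B J s ρ} .{{_ : NonZero J}} →
  2 * ((101 * A) ^ J * blockConstant J) ≤ (150 * B) ^ J * (J * J) ^ J →
  404 * A ≤ 32 * (150 * B) → ρ ≤ J → 9 + 5 * J ≤ s →
  let N = ρ + s * J in
  404 * ((101 * A) ^ N * prodTo (weight s) N) ≤ (150 * B) ^ N * (N * N) ^ N
exponential-gain {A} {B} {J} {s} {ρ} gain loss ρ≤J 9+5J≤s = begin
  404 * ((101 * A) ^ N * prodTo (weight s) N)
    ≤⟨ *-monoʳ-≤ 404 (*-monoʳ-≤ ((101 * A) ^ N) prod≤) ⟩
  404 * ((101 * A) ^ N * ((c * (s * s) ^ J) ^ s * (4 * (N * N)) ^ ρ))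
    ≡⟨ cong (λ x → 404 * (x * ((c * (s * s) ^ J) ^ s * (4 * (N * N)) ^ ρ))) (split (101 * A)) ⟩
  404 * ((101 * A) ^ ρ * ((101 * A) ^ J) ^ s * ((c * (s * s) ^ J) ^ s * (4 * (N * N)) ^ ρ))
    ≡⟨ cong (λ x → 404 * ((101 * A) ^ ρ * ((101 * A) ^ J) ^ s * (x * (4 * (N * N)) ^ ρ))) (^-distribʳ-* s c ((s * s) ^ J)) ⟩
  404 * ((101 * A) ^ ρ * ((101 * A) ^ J) ^ s * (c ^ s * σ * (4 * (N * N)) ^ ρ))
    ≡⟨ cong (λ x → 404 * ((101 * A) ^ ρ * ((101 * A) ^ J) ^ s * (c ^ s * σ * x))) (^-distribʳ-* ρ 4 (N * N)) ⟩
  404 * ((101 * A) ^ ρ * ((101 * A) ^ J) ^ s * (c ^ s * σ * (4 ^ ρ * (N * N) ^ ρ)))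
    ≡⟨ identity₁ ((101 * A) ^ ρ) (((101 * A) ^ J) ^ s) (c ^ s) σ (4 ^ ρ) ((N * N) ^ ρ) ⟩
  404 * (4 ^ ρ * (101 * A) ^ ρ) * (((101 * A) ^ J) ^ s * c ^ s) * (σ * (N * N) ^ ρ)
    ≡⟨ cong₂ (λ x y → 404 * x * y * (σ * (N * N) ^ ρ)) (trans (sym (^-distribʳ-* ρ 4 (101 * A))) (cong (_^ ρ) (sym (*-assoc 4 101 A)))) (sym (^-distribʳ-* s ((101 * A) ^ J) c)) ⟩
  404 * (404 * A) ^ ρ * ((101 * A) ^ J * c) ^ s * (σ * (N * N) ^ ρ)
    ≤⟨ *-monoˡ-≤ (σ * (N * N) ^ ρ) (*-monoˡ-≤ (((101 * A) ^ J * c) ^ s) leftover) ⟩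
  2 ^ s * (150 * B) ^ ρ * ((101 * A) ^ J * c) ^ s * (σ * (N * N) ^ ρ)
    ≡⟨ identity₂ (2 ^ s) ((150 * B) ^ ρ) (((101 * A) ^ J * c) ^ s) (σ * (N * N) ^ ρ) ⟩
  (150 * B) ^ ρ * (2 ^ s * ((101 * A) ^ J * c) ^ s) * (σ * (N * N) ^ ρ)
    ≡⟨ cong (λ x → (150 * B) ^ ρ * x * (σ * (N * N) ^ ρ)) (^-distribʳ-* s 2 ((101 * A) ^ J * c)) ⟨
  (150 * B) ^ ρ * (2 * ((101 * A) ^ J * c)) ^ s * (σ * (N * N) ^ ρ)
    ≤⟨ *-monoˡ-≤ (σ * (N * N) ^ ρ) (*-monoʳ-≤ ((150 * B) ^ ρ) (^-monoˡ-≤ s gain)) ⟩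
  (150 * B) ^ ρ * ((150 * B) ^ J * (J * J) ^ J) ^ s * (σ * (N * N) ^ ρ)
    ≡⟨ cong (λ x → (150 * B) ^ ρ * x * (σ * (N * N) ^ ρ)) (^-distribʳ-* s ((150 * B) ^ J) ((J * J) ^ J)) ⟩
  (150 * B) ^ ρ * (((150 * B) ^ J) ^ s * ((J * J) ^ J) ^ s) * (σ * (N * N) ^ ρ)
    ≡⟨ identity₃ ((150 * B) ^ ρ) (((150 * B) ^ J) ^ s) (((J * J) ^ J) ^ s) σ ((N * N) ^ ρ) ⟩
  (150 * B) ^ ρ * ((150 * B) ^ J) ^ s * ((N * N) ^ ρ * (((J * J) ^ J) ^ s * σ))
    ≤⟨ *-mono-≤ (≤-reflexive (sym (split (150 * B)))) (*-monoʳ-≤ ((N * N) ^ ρ) scale) ⟩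
  (150 * B) ^ N * ((N * N) ^ ρ * ((N * N) ^ J) ^ s)
    ≡⟨ cong ((150 * B) ^ N *_) (split (N * N)) ⟨
  (150 * B) ^ N * (N * N) ^ N ∎
  where
  open ≤-Reasoning
  N = ρ + s * J
  c = blockConstant J
  σ = ((s * s) ^ J) ^ s
  split : ∀ x → x ^ N ≡ x ^ ρ * (x ^ J) ^ s
  split x = trans (^-distribˡ-+-* x ρ (s * J)) (cong (x ^ ρ *_) (trans (cong (x ^_) (*-comm s J)) (sym (^-*-assoc x J s))))
  -- As `J` is positive, `s ≤ N`; so a leftover factor is at most `4 * (N * N)`.
  N+s≤2N : N + s ≤ 2 * N
  N+s≤2N = +-monoʳ-≤ N (≤-trans (m≤m*n s J) (≤-trans (m≤n+m (s * J) ρ) (m≤m+n N 0)))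
  prod≤ : prodTo (weight s) N ≤ (c * (s * s) ^ J) ^ s * (4 * (N * N)) ^ ρ
  prod≤ = ≤-trans (prodTo-weight-+ s (s * J) ρ) (*-mono-≤ (prodTo-weight-blocks s J)
    (^-monoˡ-≤ ρ (≤-trans (*-mono-≤ N+s≤2N N+s≤2N) (≤-reflexive (identity N)))))
    where
    identity : ∀ N → 2 * N * (2 * N) ≡ 4 * (N * N)
    identity = solve-∀
  scale : ((J * J) ^ J) ^ s * σ ≤ ((N * N) ^ J) ^ s
  scale = begin
    ((J * J) ^ J) ^ s * σ              ≡⟨ ^-distribʳ-* s ((J * J) ^ J) ((s * s) ^ J) ⟨
    ((J * J) ^ J * (s * s) ^ J) ^ s  ≡⟨ cong (_^ s) (^-distribʳ-* J (J * J) (s * s)) ⟨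
    ((J * J * (s * s)) ^ J) ^ s        ≤⟨ ^-monoˡ-≤ s (^-monoˡ-≤ J (≤-trans (≤-reflexive ([m*n]*[o*p]≡[m*o]*[n*p] J J s s)) (*-mono-≤ Js≤N Js≤N))) ⟩
    ((N * N) ^ J) ^ s                      ∎
    where
    Js≤N : J * s ≤ N
    Js≤N = ≤-trans (≤-reflexive (*-comm J s)) (m≤n+m (s * J) ρ)
  -- 404 is below `2 ^ 9` and each leftover factor costs 32 = `2 ^ 5`, so `9 + 5 * ρ` of the `s`
  -- gained factors 2 suffice.
  leftover : 404 * (404 * A) ^ ρ ≤ 2 ^ s * (150 * B) ^ ρ
  leftover = begin
    404 * (404 * A) ^ ρ                    ≤⟨ *-mono-≤ (≤ᵇ⇒≤ 404 (2 ^ 9) tt) (^-monoˡ-≤ ρ loss) ⟩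
    2 ^ 9 * (32 * (150 * B)) ^ ρ           ≡⟨ cong (2 ^ 9 *_) (^-distribʳ-* ρ 32 (150 * B)) ⟩
    2 ^ 9 * (32 ^ ρ * (150 * B) ^ ρ)       ≡⟨ *-assoc (2 ^ 9) (32 ^ ρ) ((150 * B) ^ ρ) ⟨
    2 ^ 9 * (2 ^ 5) ^ ρ * (150 * B) ^ ρ    ≡⟨ cong (λ x → 2 ^ 9 * x * (150 * B) ^ ρ) (^-*-assoc 2 5 ρ) ⟩
    2 ^ 9 * 2 ^ (5 * ρ) * (150 * B) ^ ρ    ≡⟨ cong (_* (150 * B) ^ ρ) (^-distribˡ-+-* 2 9 (5 * ρ)) ⟨
    2 ^ (9 + 5 * ρ) * (150 * B) ^ ρ        ≤⟨ *-monoˡ-≤ ((150 * B) ^ ρ) (^-monoʳ-≤ 2 (≤-trans (+-monoʳ-≤ 9 (*-monoʳ-≤ 5 ρ≤J)) 9+5J≤s)) ⟩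
    2 ^ s * (150 * B) ^ ρ                  ∎
  identity₁ : ∀ a b c σ d e → 404 * (a * b * (c * σ * (d * e))) ≡ 404 * (d * a) * (b * c) * (σ * e)
  identity₁ = solve-∀
  identity₂ : ∀ a b c d → a * b * c * d ≡ b * (a * c) * d
  identity₂ = solve-∀
  identity₃ : ∀ a b c d e → a * (b * c) * (d * e) ≡ a * b * (e * (c * d))
  identity₃ = solve-∀

-- Settled by evaluation. With 100 blocks, `(101 !)²` is close enough to `(100 / e) ^ 200` for the
-- margin between 2 + log(3/2) and 2.117 to survive all roundings.
gain-check : 2 * ((101 * 1000 ^ 73) ^ 100 * blockConstant 100) ≤ (150 * 971 ^ 73) ^ 100 * (100 * 100) ^ 100
gain-check = ≤ᵇ⇒≤ _ _ tt

loss-check : 404 * 1000 ^ 73 ≤ 32 * (150 * 971 ^ 73)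
loss-check = ≤ᵇ⇒≤ _ _ tt

-- Truncated exponential series in the natural numbers.

^-mean-value : ∀ k y a → (y + a) ^ suc k ≤ y ^ suc k + suc k * (a * (y + a) ^ k)
^-mean-value zero    y a = ≤-reflexive (identity y a)
  where
  identity : ∀ y a → (y + a) * 1 ≡ y * 1 + 1 * (a * 1)
  identity = solve-∀
^-mean-value (suc k) y a = begin
  (y + a) * z                                          ≡⟨ *-distribʳ-+ z y a ⟩
  y * z + a * z                                        ≤⟨ +-monoˡ-≤ (a * z) (*-monoʳ-≤ y (^-mean-value k y a)) ⟩
  y * (y ^ suc k + suc k * (a * (y + a) ^ k)) + a * z  ≤⟨ +-monoˡ-≤ (a * z) (≤-trans (≤-reflexive (*-distribˡ-+ y (y ^ suc k) _)) (+-monoʳ-≤ (y * y ^ suc k) (*-monoˡ-≤ (suc k * (a * (y + a) ^ k)) (m≤m+n y a)))) ⟩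
  y * y ^ suc k + (y + a) * (suc k * (a * (y + a) ^ k)) + a * z  ≡⟨ identity (y * y ^ suc k) (y + a) k a ((y + a) ^ k) ⟩
  y * y ^ suc k + suc (suc k) * (a * z)                ∎
  where
  open ≤-Reasoning
  z = (y + a) ^ suc k
  identity : ∀ x u k a v → x + u * (suc k * (a * v)) + a * (u * v) ≡ x + suc (suc k) * (a * (u * v))
  identity = solve-∀

-- D^K · K! times the Taylor polynomial of degree K of exp at y / D.
expNumerator : ℕ → ℕ → ℕ → ℕ
expNumerator D zero    y = 1
expNumerator D (suc K) y = D * suc K * expNumerator D K y + y ^ suc K

-- exp(x) − exp(x − h) ≤ h · exp(x), truncated; the extra summand a·(y+a)^K carries the induction.
expNumerator-+ : ∀ D a K y → D * expNumerator D K (y + a) + a * (y + a) ^ K ≤ D * expNumerator D K y + a * expNumerator D K (y + a)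
expNumerator-+ D a zero    y = ≤-refl
expNumerator-+ D a (suc K) y = +-cancelʳ-≤ (D * suc K * (a * z)) _ _ (begin
  D * (D * suc K * E′ + z₁) + a * z₁ + D * suc K * (a * z)                    ≡⟨ identity₁ D K E′ a z z₁ ⟩
  D * suc K * (D * E′ + a * z) + D * z₁ + a * z₁                              ≤⟨ +-monoˡ-≤ (a * z₁) (+-mono-≤ (*-monoʳ-≤ (D * suc K) (expNumerator-+ D a K y)) (*-monoʳ-≤ D (^-mean-value K y a))) ⟩
  D * suc K * (D * E + a * E′) + D * (y ^ suc K + suc K * (a * z)) + a * z₁   ≡⟨ identity₂ D K E E′ a z z₁ (y ^ suc K) ⟩
  D * (D * suc K * E + y ^ suc K) + a * (D * suc K * E′ + z₁) + D * suc K * (a * z) ∎)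
  where
  open ≤-Reasoning
  E  = expNumerator D K y
  E′ = expNumerator D K (y + a)
  z  = (y + a) ^ K
  z₁ = (y + a) ^ suc K
  identity₁ : ∀ D K E′ a z z₁ → D * (D * suc K * E′ + z₁) + a * z₁ + D * suc K * (a * z) ≡ D * suc K * (D * E′ + a * z) + D * z₁ + a * z₁
  identity₁ = solve-∀
  identity₂ : ∀ D K E E′ a z z₁ x → D * suc K * (D * E + a * E′) + D * (x + suc K * (a * z)) + a * z₁ ≡ D * (D * suc K * E + x) + a * (D * suc K * E′ + z₁) + D * suc K * (a * z)
  identity₂ = solve-∀

-- With `h = a / (b + a)` this is the truncated form of (1 - h) · exp(x + h) ≤ exp(x).
expNumerator-step : ∀ b a K y → b * expNumerator (b + a) K (y + a) ≤ (b + a) * expNumerator (b + a) K y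
expNumerator-step b a K y = +-cancelʳ-≤ (a * E′) _ _ (≤-trans
  (≤-reflexive (sym (*-distribʳ-+ E′ b a)))
  (≤-trans (m≤m+n ((b + a) * E′) (a * (y + a) ^ K)) (expNumerator-+ (b + a) a K y)))
  where E′ = expNumerator (b + a) K (y + a)

expNumerator-zero : ∀ D K → expNumerator D K 0 ≡ D ^ K * K !
expNumerator-zero D zero    = refl
expNumerator-zero D (suc K) = trans (cong (λ x → D * suc K * x + 0) (expNumerator-zero D K)) (identity D K (D ^ K) (K !))
  where
  identity : ∀ D K x f → D * suc K * (x * f) + 0 ≡ D * x * (suc K * f)
  identity = solve-∀

-- Iterating the step `j` times from 0 gives exp(jh) ≤ (1 - h)^(-j) with `h = a / (b + a)`.
expNumerator-bound : ∀ b a K j → b ^ j * expNumerator (b + a) K (j * a) ≤ (b + a) ^ j * ((b + a) ^ K * K !)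
expNumerator-bound b a K zero    = ≤-reflexive (cong (1 *_) (expNumerator-zero (b + a) K))
expNumerator-bound b a K (suc j) = begin
  b ^ suc j * F (a + j * a)                ≡⟨ cong (λ x → b ^ suc j * F x) (+-comm a (j * a)) ⟩
  b * b ^ j * F (j * a + a)                ≡⟨ identity b (b ^ j) (F (j * a + a)) ⟩
  b ^ j * (b * F (j * a + a))              ≤⟨ *-monoʳ-≤ (b ^ j) (expNumerator-step b a K (j * a)) ⟩
  b ^ j * ((b + a) * F (j * a))            ≡⟨ identity′ (b ^ j) (b + a) (F (j * a)) ⟩
  (b + a) * (b ^ j * F (j * a))            ≤⟨ *-monoʳ-≤ (b + a) (expNumerator-bound b a K j) ⟩
  (b + a) * ((b + a) ^ j * ((b + a) ^ K * K !)) ≡⟨ *-assoc (b + a) ((b + a) ^ j) _ ⟨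
  (b + a) ^ suc j * ((b + a) ^ K * K !)    ∎
  where
  open ≤-Reasoning
  F = expNumerator (b + a) K
  identity : ∀ b x y → b * x * y ≡ x * (b * y)
  identity = solve-∀
  identity′ : ∀ x b y → x * (b * y) ≡ b * (x * y)
  identity′ = solve-∀

-- Transfer to the rational bound.

toℚᵘ-/ : ∀ i n .{{_ : NonZero n}} → ℚ.toℚᵘ (i ℚ./ n) ≃ i ℚᵘ./ n
toℚᵘ-/ i (suc n) = ℚ.toℚᵘ-fromℚᵘ (mkℚᵘ i n)

/-+-/ : ∀ e d {d′} .{{_ : NonZero d}} .{{_ : NonZero d′}} x y → d′ ≡ e * d →
  ((ℤ.+ x) ℚᵘ./ d) ℚᵘ.+ ((ℤ.+ y) ℚᵘ./ d′) ≃ (ℤ.+ (e * x + y)) ℚᵘ./ d′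
/-+-/ e (suc d) {suc d′} x y eq = *≡* (begin
  (ℤ.+ x ℤ.* ℤ.+ suc d′ ℤ.+ ℤ.+ y ℤ.* ℤ.+ suc d) ℤ.* ℤ.+ suc d′  ≡⟨ cong (ℤ._* ℤ.+ suc d′) (cong₂ ℤ._+_ (sym (ℤ.pos-* x (suc d′))) (sym (ℤ.pos-* y (suc d)))) ⟩
  ℤ.+ (x * suc d′ + y * suc d) ℤ.* ℤ.+ suc d′                   ≡⟨ ℤ.pos-* (x * suc d′ + y * suc d) (suc d′) ⟨
  ℤ.+ ((x * suc d′ + y * suc d) * suc d′)                       ≡⟨ cong (λ z → ℤ.+ ((x * z + y * suc d) * suc d′)) eq ⟩
  ℤ.+ ((x * (e * suc d) + y * suc d) * suc d′)                  ≡⟨ cong ℤ.+_ (identity x e (suc d) y (suc d′)) ⟩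
  ℤ.+ ((e * x + y) * (suc d * suc d′))                          ≡⟨ ℤ.pos-* (e * x + y) (suc d * suc d′) ⟩
  ℤ.+ (e * x + y) ℤ.* ℤ.+ (suc d * suc d′)                      ∎)
  where
  open ≡-Reasoning
  identity : ∀ x e d y d′ → (x * (e * d) + y * d) * d′ ≡ (e * x + y) * (d * d′)
  identity = solve-∀

-- Over the denominators `1000 ^ K * K !` the numerators follow the recursion of `expNumerator`. The
-- index is `suc K` because `expPartial` counts terms while `expNumerator` is indexed by degree.
expPartial-numerator : ∀ n K → ℚ.toℚᵘ (expPartial n (suc K)) ≃
  ℚᵘ._/_ (ℤ.+ expNumerator 1000 K (2117 * n)) (1000 ^ K * K !) {{m*n≢0 (1000 ^ K) (K !) {{pow-nz 1000 K}} {{K !≢0}}}}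
expPartial-numerator n zero    = *≡* refl
expPartial-numerator n (suc K) = ℚᵘ.≃-trans (ℚ.toℚᵘ-homo-+ (expPartial n (suc K)) (expTerm n (suc K)))
  (ℚᵘ.≃-trans (ℚᵘ.+-cong (expPartial-numerator n K) (toℚᵘ-/ (ℤ.+ ((2117 * n) ^ suc K)) (1000 ^ suc K * suc K !) {{nz (suc K)}}))
    (/-+-/ (1000 * suc K) (1000 ^ K * K !) {{nz K}} {{nz (suc K)}} (expNumerator 1000 K (2117 * n)) ((2117 * n) ^ suc K) (identity K (1000 ^ K) (K !))))
  where
  nz : ∀ K → NonZero (1000 ^ K * K !)
  nz K = m*n≢0 (1000 ^ K) (K !) {{pow-nz 1000 K}} {{K !≢0}}
  identity : ∀ K x f → 1000 * x * (suc K * f) ≡ 1000 * suc K * (x * f)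
  identity = solve-∀

/-*-≤ : ∀ T x d N .{{_ : NonZero d}} → T * x ≤ N * d → ((ℤ.+ T) ℚᵘ./ 1) ℚᵘ.* ((ℤ.+ x) ℚᵘ./ d) ℚᵘ.≤ (ℤ.+ N) ℚᵘ./ 1
/-*-≤ T x (suc d) N le = *≤* (begin
  ℤ.+ T ℤ.* ℤ.+ x ℤ.* ℤ.+ 1     ≡⟨ ℤ.*-identityʳ (ℤ.+ T ℤ.* ℤ.+ x) ⟩
  ℤ.+ T ℤ.* ℤ.+ x               ≡⟨ ℤ.pos-* T x ⟨
  ℤ.+ (T * x)                   ≤⟨ ℤ.+≤+ le ⟩
  ℤ.+ (N * suc d)               ≡⟨ ℤ.pos-* N (suc d) ⟩
  ℤ.+ N ℤ.* ℤ.+ suc d           ≡⟨ cong (λ z → ℤ.+ N ℤ.* ℤ.+ z) (*-identityˡ (suc d)) ⟨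
  ℤ.+ N ℤ.* ℤ.+ (1 * suc d)     ∎)
  where open ℤ.≤-Reasoning

-- 2117 = 73 · 29 and 1000 = 971 + 29, so e^{2.117} ≤ (1 − 0.029)^{-73}.
belowBound : ∀ n T → T * (1000 ^ 73) ^ n ≤ (971 ^ 73) ^ n * n ^ n → BelowBound n T
belowBound n T le zero    = ℚ.≤-trans (ℚ.≤-reflexive (ℚ.*-zeroʳ (ℤ.+ T ℚ./ 1))) (ℚ.nonNegative⁻¹ (ℤ.+ (n ^ n) ℚ./ 1) {{ℚ.normalize-nonNeg (n ^ n) 1}})
belowBound n T le (suc K) = ℚ.toℚᵘ-cancel-≤ (begin
  ℚ.toℚᵘ ((ℤ.+ T ℚ./ 1) ℚ.* expPartial n (suc K))           ≃⟨ ℚ.toℚᵘ-homo-* (ℤ.+ T ℚ./ 1) (expPartial n (suc K)) ⟩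
  ℚ.toℚᵘ (ℤ.+ T ℚ./ 1) ℚᵘ.* ℚ.toℚᵘ (expPartial n (suc K))   ≃⟨ ℚᵘ.*-cong (toℚᵘ-/ (ℤ.+ T) 1) (expPartial-numerator n K) ⟩
  (ℤ.+ T ℚᵘ./ 1) ℚᵘ.* ℚᵘ._/_ (ℤ.+ E) D {{D≢0}}                    ≤⟨ /-*-≤ T E D (n ^ n) {{D≢0}} T*E≤ ⟩
  ℤ.+ (n ^ n) ℚᵘ./ 1                                           ≃⟨ toℚᵘ-/ (ℤ.+ (n ^ n)) 1 ⟨
  ℚ.toℚᵘ (ℤ.+ (n ^ n) ℚ./ 1)                                ∎)
  where
  open ℚᵘ.≤-Reasoning
  E = expNumerator 1000 K (2117 * n)
  D = 1000 ^ K * K !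
  D≢0 : NonZero D
  D≢0 = m*n≢0 (1000 ^ K) (K !) {{pow-nz 1000 K}} {{K !≢0}}
  E≤ : (971 ^ 73) ^ n * E ≤ (1000 ^ 73) ^ n * D
  E≤ = subst₂ _≤_
    (cong₂ _*_ (sym (^-*-assoc 971 73 n)) (cong (expNumerator 1000 K) (identity n)))
    (cong (_* D) (sym (^-*-assoc 1000 73 n)))
    (expNumerator-bound 971 29 K (73 * n))
    where
    identity : ∀ n → 73 * n * 29 ≡ 2117 * n
    identity = solve-∀
  T*E≤ : T * E ≤ n ^ n * D
  T*E≤ = *-cancelˡ-≤ β {{m^n≢0 (971 ^ 73) n}}
    (≤-trans (≤-reflexive (identity₁ β T E))
    (≤-trans (*-monoʳ-≤ T E≤)
    (≤-trans (≤-reflexive (sym (*-assoc T α D)))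
    (≤-trans (*-monoˡ-≤ D le)
    (≤-reflexive (*-assoc β (n ^ n) D))))))
    where
    α = (1000 ^ 73) ^ n
    β = (971 ^ 73) ^ n
    identity₁ : ∀ b t e → b * (t * e) ≡ t * (b * e)
    identity₁ = solve-∀

-- Assembly of the bound.

size-complement : ∀ {T} {P : Fin T → Set} (P? : ∀ i → Dec (P i)) → size P? + size (λ i → ¬? (P? i)) ≡ T
size-complement {T} P? = begin
  size P? + size (λ i → ¬? (P? i))             ≡⟨ ∑-distrib-+ (λ i → 𝟙 (P? i)) (λ i → 𝟙 (¬? (P? i))) ⟨
  ∑[ i < T ] (𝟙 (P? i) + 𝟙 (¬? (P? i)))        ≡⟨ sum-cong-≗ (λ i → complement (P? i)) ⟩
  ∑[ i < T ] 1                                 ≡⟨ trans (sum-const T 1) (*-identityʳ T) ⟩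
  T                                            ∎
  where
  open ≡-Reasoning
  complement : ∀ {P : Set} (d : Dec P) → 𝟙 d + 𝟙 (¬? d) ≡ 1
  complement (yes _) = refl
  complement (no _)  = refl

-- For odd `q`, the transversals avoiding the diagonal blocks and those inside them are counted
-- separately, each with at most `2 * q` allowed cells per row; hence 404 = 202 + 202.
∃-square-with-few-transversals : ∀ q s .{{_ : NonZero q}} .{{_ : NonZero s}} → 401 ≤ q * 3 → 600 * (q * 3) ≤ s * s →
  let N = q * 3 in
  Σ (LatinSquare N) λ L → ∀ T (t : Fin T → Transversal L) → (∀ i j → SameTransversal (t i) (t j) → i ≡ j) →
    T * (150 * N) ^ N ≤ 404 * (101 ^ N * prodTo (weight s) N)
∃-square-with-few-transversals q s 401≤N 600N≤s² with even⊎odd q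
... | inj₁ (h , q≡) = Square.square q 0 , λ
  { zero    t distinct → z≤n
  ; (suc T) t distinct → contradiction (t zero) (even-no-transversal q h q≡)
  }
... | inj₂ (h , q≡) = square , λ T t distinct → bound T t distinct
  where
  open Square q 1
  open ≤-Reasoning
  N = q * 3
  M = 101 ^ N * prodTo (weight s) N
  identity : ∀ q → 3 * (q * 2) ≡ 2 * (q * 3)
  identity = solve-∀
  double : ∀ M → 202 * M + 202 * M ≡ 404 * M
  double = solve-∀
  bound : ∀ T (t : Fin T → Transversal square) → (∀ i j → SameTransversal (t i) (t j) → i ≡ j) → T * (150 * N) ^ N ≤ 404 * M
  bound T t distinct = begin
    T * (150 * N) ^ N                                               ≡⟨ cong (_* (150 * N) ^ N) (size-complement avoids?) ⟨
    (size avoids? + size (λ i → ¬? (avoids? i))) * (150 * N) ^ N    ≡⟨ *-distribʳ-+ ((150 * N) ^ N) (size avoids?) (size (λ i → ¬? (avoids? i))) ⟩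
    size avoids? * (150 * N) ^ N + size (λ i → ¬? (avoids? i)) * (150 * N) ^ N
      ≤⟨ +-mono-≤
           (transversal-count-bound square (λ r c → ¬? (class r ≟ class c)) t distinct avoids? (λ _ avoids → avoids)
             401≤N 600N≤s² (≤-reflexive (identity q)) (λ r → ≤-reflexive (trans (sum-class (λ j → 𝟙 (¬? (class r ≟ j)))) (cong (q *_) (sum-𝟙-≢ (class r))))))
           (transversal-count-bound square (λ r c → class r ≟ class c) t distinct (λ i → ¬? (avoids? i)) diagonal
             401≤N 600N≤s² (≤-reflexive (identity q)) (λ r → ≤-trans (≤-reflexive (trans (sum-class (λ j → 𝟙 (class r ≟ j))) (cong (q *_) (sum-𝟙-≡ (class r))))) (*-monoʳ-≤ q (s≤s z≤n)))) ⟩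
    202 * M + 202 * M                                               ≡⟨ double M ⟩
    404 * M                                                         ∎
    where
    avoids? : ∀ i → Dec (∀ r → class r ≢ class (col (t i) r))
    avoids? i = all? λ r → ¬? (class r ≟ class (col (t i) r))
    diagonal : ∀ i → ¬ (∀ r → class r ≢ class (col (t i) r)) → ∀ r → class r ≡ class (col (t i) r)
    diagonal i ¬avoids with odd-avoids⊎diagonal q h q≡ (t i)
    ... | inj₁ avoids = contradiction avoids ¬avoids
    ... | inj₂ same   = same

-- `exponential-gain` is applied with `J = 100`, whence 509 = 9 + 5 · 100. Of its factor
-- `(n * n) ^ n`, one `n ^ n` cancels against `(150 * n) ^ n` and the other is the claimed bound.
count⇒belowBound : ∀ {n s T} → 509 ≤ s → n ≡ n % 100 + s * 100 →
  T * (150 * n) ^ n ≤ 404 * (101 ^ n * prodTo (weight s) n) → BelowBound n T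
count⇒belowBound {n} {s} {T} 509≤s n≡ count = belowBound n T (cancel (1000 ^ 73) (971 ^ 73) gain)
  where
  open ≤-Reasoning
  gain : 404 * ((101 * 1000 ^ 73) ^ n * prodTo (weight s) n) ≤ (150 * 971 ^ 73) ^ n * (n * n) ^ n
  gain = subst (λ m → 404 * ((101 * 1000 ^ 73) ^ m * prodTo (weight s) m) ≤ (150 * 971 ^ 73) ^ m * (m * m) ^ m) (sym n≡)
    (exponential-gain {1000 ^ 73} {971 ^ 73} {100} {s} {n % 100} gain-check loss-check (<⇒≤ (m%n<n n 100)) 509≤s)
  cancel : ∀ A B → 404 * ((101 * A) ^ n * prodTo (weight s) n) ≤ (150 * B) ^ n * (n * n) ^ n → T * A ^ n ≤ B ^ n * n ^ n
  cancel A B gain = *-cancelˡ-≤ ((150 * n) ^ n) {{m^n≢0 (150 * n) n {{m*n≢0 150 n {{_}} {{n≢0}}}}}} (begin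
    (150 * n) ^ n * (T * A ^ n)                        ≡⟨ identity₁ ((150 * n) ^ n) T (A ^ n) ⟩
    A ^ n * (T * (150 * n) ^ n)                        ≤⟨ *-monoʳ-≤ (A ^ n) count ⟩
    A ^ n * (404 * (101 ^ n * P))                      ≡⟨ identity₂ (A ^ n) (101 ^ n) P ⟩
    404 * (101 ^ n * A ^ n * P)                        ≡⟨ cong (λ x → 404 * (x * P)) (^-distribʳ-* n 101 A) ⟨
    404 * ((101 * A) ^ n * P)                          ≤⟨ gain ⟩
    (150 * B) ^ n * (n * n) ^ n                        ≡⟨ cong₂ _*_ (^-distribʳ-* n 150 B) (^-distribʳ-* n n n) ⟩
    150 ^ n * B ^ n * (n ^ n * n ^ n)                  ≡⟨ identity₃ (150 ^ n) (B ^ n) (n ^ n) ⟩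
    150 ^ n * n ^ n * (B ^ n * n ^ n)                  ≡⟨ cong (_* (B ^ n * n ^ n)) (^-distribʳ-* n 150 n) ⟨
    (150 * n) ^ n * (B ^ n * n ^ n)                    ∎)
    where
    P = prodTo (weight s) n
    n≢0 : NonZero n
    n≢0 = >-nonZero (begin
      1                  ≤⟨ s≤s z≤n ⟩
      509                ≤⟨ 509≤s ⟩
      s                  ≤⟨ m≤m*n s 100 ⟩
      s * 100            ≤⟨ m≤n+m (s * 100) (n % 100) ⟩
      n % 100 + s * 100  ≡⟨ n≡ ⟨
      n                  ∎)
    identity₁ : ∀ x t a → x * (t * a) ≡ a * (t * x)
    identity₁ = solve-∀
    identity₂ : ∀ a x p → a * (404 * (x * p)) ≡ 404 * (x * a * p)
    identity₂ = solve-∀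
    identity₃ : ∀ a b c → a * b * (c * c) ≡ a * c * (b * c)
    identity₃ = solve-∀

theorem1p1 : ∃ λ (N : ℕ) → ∀ (n : ℕ) → n ≥ N → 3 ∣ n →
    Σ (LatinSquare n) FewTransversals
theorem1p1 = 12000000 , construct
  where
  construct : ∀ n → n ≥ 12000000 → 3 ∣ n → Σ (LatinSquare n) FewTransversals
  construct _ n≥N (divides zero    refl) = contradiction n≥N λ ()
  construct n n≥N (divides q@(suc _) refl) =
    let L , count = ∃-square-with-few-transversals q s 401≤n 600n≤s²
    in L , λ T t distinct → count⇒belowBound {T = T} (≤-trans (≤ᵇ⇒≤ 509 120000 _) 120000≤s) n≡ (count T t distinct)
    where
    open ≤-Reasoning
    -- The shift is also the block length. The threshold 12000000 gives `s ≥ 120000`, and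
    -- `n ≤ 200 * s` then yields `600 * n ≤ 120000 * s ≤ s * s`.
    s = n / 100
    120000≤s : 120000 ≤ s
    120000≤s = /-monoˡ-≤ 100 n≥N
    n≡ : n ≡ n % 100 + s * 100
    n≡ = m≡m%n+[m/n]*n n 100
    instance
      s≢0 : NonZero s
      s≢0 = >-nonZero (≤-trans (≤ᵇ⇒≤ 1 120000 _) 120000≤s)
    401≤n : 401 ≤ n
    401≤n = ≤-trans (≤ᵇ⇒≤ 401 12000000 _) n≥N
    identity : ∀ s → 600 * (s * 100 + s * 100) ≡ 120000 * s
    identity = solve-∀
    600n≤s² : 600 * n ≤ s * s
    600n≤s² = begin
      600 * n                      ≡⟨ cong (600 *_) n≡ ⟩
      600 * (n % 100 + s * 100)    ≤⟨ *-monoʳ-≤ 600 (+-monoˡ-≤ (s * 100) (≤-trans (<⇒≤ (m%n<n n 100)) (m≤n*m 100 s))) ⟩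
      600 * (s * 100 + s * 100)    ≡⟨ identity s ⟩
      120000 * s                   ≤⟨ *-monoˡ-≤ s 120000≤s ⟩
      s * s                        ∎
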